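{- Let $q$ be even and let $\mathcal U$ be a non-classical orthogonal Buekenhout–Metz unital with respect to $\ell_\infty$ in $\mathrm{PG}(2,q^2)$. Let $P$ be a point with $P\notin\mathcal U\cup\ell_\infty$. Then (1) the points of $\mathrm{pedal}(P)$ lie on the lines of a Baer pencil whose vertex is a point of $\ell_\infty$, and (2) $\mathrm{pedal}(P)$ is an arc.
   Context: Points of $\mathrm{PG}(2,q^2)$ have homogeneous coordinates $(x,y,z)$; $\ell_\infty$ is the line $z=0$. For $q$ even, an orthogonal Buekenhout–Metz unital with respect to $\ell_\infty$ is (up to a collineation fixing $\ell_\infty$) a set $\mathcal U_{\alpha\beta}=\{(x,\alpha x^2+\beta x^{q+1}+r,1): x\in\mathbb{F}_{q^2}, r\in\mathbb{F}_q\}\cup\{(0,1,0)\}$ where $\alpha,\beta\in\mathbb{F}_{q^2}$, $\beta\notin\mathbb{F}_q$ and $\alpha^{q+1}/(\beta^q+\beta)^2$ has absolute trace $0$ in $\mathbb{F}_q$ (originally defined as the unitals corresponding to an elliptic cone containing a spread line in the Bruck–Bose representation in $\mathrm{PG}(4,q)$ with respect to $\ell_\infty$); it is non-classical iff $\alpha\neq0$. A unital is a set of $q^3+1$ points meeting every line in $1$ or $q+1$ points; a tangent is a line meeting it in exactly one point. For $P$ not on the unital, the $q+1$ tangents through $P$ meet the unital in the feet of $P$, forming $\mathrm{pedal}(P)$. An arc is a point set meeting every line in at most $2$ points. A Baer subline is a set of $q+1$ points of a line projectively equivalent to $\{(a,b,0):(a,b)\in\mathbb{F}_q^2\setminus\{0\}\}$;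 a Baer pencil is the set of $q+1$ lines joining a vertex point to the points of a Baer subline. -}

module Defs where

open import Algebra.Apartness.Bundles using (HeytingField; HeytingCommutativeRing)
open import Algebra.Bundles using (CommutativeRing)
import Algebra.Apartness.Properties.HeytingCommutativeRing as HCRProperties
import Algebra.Properties.Semiring.Exp as Exp
import Algebra.Properties.Semiring.Sum as Sum
open import Data.Fin.Base using (Fin; toℕ)
open import Data.Nat.Base as ℕ using (ℕ)
open import Data.Product.Base using (Σ; ∃; ∃₂; _×_; _,_; proj₁)
open import Data.Sum.Base using (_⊎_)
open import Data.Vec.Functional using (Vector; []; _∷_; zipWith)
open import Function.Bundles using (Inverse; _⇔_)
open import Level as Level using (Level; _⊔_)
open import Relation.Binary.Bundles using (Setoid)
open import Relation.Binary.Structures using (IsEquivalence)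
import Relation.Binary.PropositionalEquality as ≡
open import Relation.Nullary.Negation using (¬_)
open import Relation.Unary using (Pred; _∈_; _∉_; _≐_)

private
  variable
    a b : Level

-- In a field of finite order, _≈_ and _#_ are decidable and x # y holds
-- exactly when x ≉ y, so this is the usual notion of a field with n elements.
HasOrder : ∀ {c ℓ₁ ℓ₂} → HeytingField c ℓ₁ ℓ₂ → ℕ → Set (c ⊔ ℓ₁)
HasOrder K n = Inverse (CommutativeRing.setoid commutativeRing) (≡.setoid (Fin n))
  where
  open HeytingCommutativeRing (HeytingField.heytingCommutativeRing K)

-- The plane over K with q = 2 ^ h.  It is PG(2,q²) once K has order q².
module Plane {c ℓ₁ ℓ₂} (h : ℕ) (K : HeytingField c ℓ₁ ℓ₂) where

  open HeytingField K
  open HCRProperties heytingCommutativeRing using (1#0; x#0y#0→xy#0; invertibleˡ⇒#; x-0≈x)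
  open HeytingCommutativeRing heytingCommutativeRing using (commutativeRing)
  open CommutativeRing commutativeRing using (semiring)
  open Exp semiring using (_^_)
  open Sum semiring using (sum)

  q : ℕ
  q = 2 ℕ.^ h

  -- The subfield 𝔽_q of 𝔽_{q²}, as the fixed set of the Frobenius map x ↦ x^q.
  𝔽q : Pred Carrier ℓ₁
  𝔽q x = x ^ q ≈ x

  -- The absolute trace 𝔽_q → 𝔽_2, for q = 2^h.
  Tr : Carrier → Carrier
  Tr t = sum {h} (λ i → t ^ (2 ℕ.^ toℕ i))

  Triple : Set c
  Triple = Vector Carrier 3

  ⟨_,_,_⟩ : Carrier → Carrier → Carrier → Triple
  ⟨ x , y , z ⟩ = x ∷ y ∷ z ∷ []

  infix 4 _∼_
  _∼_ : Triple → Triple → Set (c ⊔ ℓ₁ ⊔ ℓ₂)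
  u ∼ v = ∃ λ k → k # 0# × (∀ i → k * u i ≈ v i)

  Point : Set (c ⊔ ℓ₂)
  Point = Σ Triple λ v → ∃ λ i → v i # 0#

  coords : Point → Triple
  coords = proj₁

  infix 4 _≈ₚ_
  _≈ₚ_ : Point → Point → Set (c ⊔ ℓ₁ ⊔ ℓ₂)
  P ≈ₚ Q = coords P ∼ coords Q

  ≈ₚ-isEquivalence : IsEquivalence _≈ₚ_
  ≈ₚ-isEquivalence = record
    { refl  = 1# , 1#0 , λ i → *-identityˡ _
    ; sym   = λ {P} {Q} → ≈ₚ-sym {P} {Q}
    ; trans = λ { (k , k#0 , e) (l , l#0 , f) →
        l * k , x#0y#0→xy#0 l#0 k#0 ,
        λ i → trans (*-assoc _ _ _) (trans (*-congˡ (e i)) (f i)) }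
    }
    where
    ≈ₚ-sym : ∀ {P Q} → P ≈ₚ Q → Q ≈ₚ P
    ≈ₚ-sym (k , k#0 , e) with #⇒invertible k#0
    ... | k⁻¹ , inv , inv′ = k⁻¹ , k⁻¹#0 , λ i →
          trans (*-congˡ (sym (e i)))
            (trans (sym (*-assoc _ _ _))
              (trans (*-congʳ k⁻¹k≈1) (*-identityˡ _)))
      where
      k⁻¹k≈1 : k⁻¹ * k ≈ 1#
      k⁻¹k≈1 = trans (*-congˡ (sym (x-0≈x k))) inv
      k⁻¹#0 : k⁻¹ # 0#
      k⁻¹#0 = invertibleˡ⇒#
        (k , trans (*-congˡ (x-0≈x k⁻¹)) (trans (*-comm _ _) k⁻¹k≈1))

  pointSetoid : Setoid (c ⊔ ℓ₂) (c ⊔ ℓ₁ ⊔ ℓ₂)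
  pointSetoid = record { isEquivalence = ≈ₚ-isEquivalence }

  -- The line with coordinates [a,b,c] is ax + by + cz = 0.
  Line : Set (c ⊔ ℓ₂)
  Line = Point

  infix 4 _I_
  _I_ : Point → Line → Set ℓ₁
  P I m = sum (zipWith _*_ (coords m) (coords P)) ≈ 0#

  ℓ∞ : Line
  ℓ∞ = ⟨ 0# , 0# , 1# ⟩ , Fin.suc (Fin.suc Fin.zero) , 1#0

  record Collineation : Set (c ⊔ ℓ₁ ⊔ ℓ₂) where
    field
      onPoints       : Inverse pointSetoid pointSetoid
      preservesLines : ∀ m → ∃ λ m′ → ∀ P → P I m ⇔ Inverse.to onPoints P I m′

    image : Pred Point a → Pred Point (c ⊔ ℓ₁ ⊔ ℓ₂ ⊔ a)
    image S P = ∃ λ Q → Q ∈ S × Inverse.to onPoints Q ≈ₚ P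

    Fixes : Line → Set (c ⊔ ℓ₁ ⊔ ℓ₂)
    Fixes m = ∀ P → P I m ⇔ Inverse.to onPoints P I m

  Matrix : Set c
  Matrix = Fin 3 → Fin 3 → Carrier

  infixr 7 _*ᵥ_
  _*ᵥ_ : Matrix → Triple → Triple
  (M *ᵥ v) i = sum (zipWith _*_ (M i) v)

  record Projectivity : Set (c ⊔ ℓ₁) where
    field
      matrix   : Matrix
      inverse  : Matrix
      inverseˡ : ∀ v i → (inverse *ᵥ matrix *ᵥ v) i ≈ v i
      inverseʳ : ∀ v i → (matrix *ᵥ inverse *ᵥ v) i ≈ v i

    image : Pred Point a → Pred Point (c ⊔ ℓ₁ ⊔ ℓ₂ ⊔ a)
    image S P = ∃ λ Q → Q ∈ S × matrix *ᵥ coords Q ∼ coords P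

  ProjectivelyEquivalent : Pred Point a → Pred Point b → Set (c ⊔ ℓ₁ ⊔ ℓ₂ ⊔ a ⊔ b)
  ProjectivelyEquivalent S T = ∃ λ g → T ≐ Projectivity.image g S

  -- The quotient α^(q+1) / (β^q+β)² is given as the t with
  -- t (β^q+β)² = α^(q+1); it is unique, since β^q + β ≠ 0 when β ∉ 𝔽_q.
  Admissible : Carrier → Carrier → Set (c ⊔ ℓ₁)
  Admissible α β = β ∉ 𝔽q
    × ∃ λ t → t * (β ^ q + β) ^ 2 ≈ α ^ (q ℕ.+ 1) × Tr t ≈ 0#

  𝒰 : Carrier → Carrier → Pred Point (c ⊔ ℓ₁ ⊔ ℓ₂)
  𝒰 α β P =
    (∃₂ λ x r → r ∈ 𝔽q
       × coords P ∼ ⟨ x , α * x ^ 2 + β * x ^ (q ℕ.+ 1) + r , 1# ⟩)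
    ⊎ coords P ∼ ⟨ 0# , 1# , 0# ⟩

  IsOrthogonalBuekenhoutMetz : Pred Point a → Set (c ⊔ ℓ₁ ⊔ ℓ₂ ⊔ a)
  IsOrthogonalBuekenhoutMetz U = ∃₂ λ α β → Admissible α β
    × ∃ λ φ → Collineation.Fixes φ ℓ∞ × U ≐ Collineation.image φ (𝒰 α β)

  hermitianCurve : Pred Point ℓ₁
  hermitianCurve P = sum (λ i → coords P i ^ (q ℕ.+ 1)) ≈ 0#

  -- All nondegenerate Hermitian curves of PG(2,q²) are projectively equivalent.
  IsClassical : Pred Point a → Set (c ⊔ ℓ₁ ⊔ ℓ₂ ⊔ a)
  IsClassical = ProjectivelyEquivalent hermitianCurve

  IsTangent : Pred Point a → Line → Set (c ⊔ ℓ₁ ⊔ ℓ₂ ⊔ a)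
  IsTangent U m = ∃ λ Q → Q ∈ U × Q I m × (∀ R → R ∈ U → R I m → R ≈ₚ Q)

  pedal : Pred Point a → Point → Pred Point (c ⊔ ℓ₁ ⊔ ℓ₂ ⊔ a)
  pedal U P Q = Q ∈ U × ∃ λ m → IsTangent U m × P I m × Q I m

  IsArc : Pred Point a → Set (c ⊔ ℓ₁ ⊔ ℓ₂ ⊔ a)
  IsArc S = ∀ m A B C → A ∈ S → B ∈ S → C ∈ S → A I m → B I m → C I m →
    A ≈ₚ B ⊎ A ≈ₚ C ⊎ B ≈ₚ C

  -- (a,b) ≠ (0,0) is automatic, as the coordinates of P are not all zero.
  standardBaerSubline : Pred Point (c ⊔ ℓ₁ ⊔ ℓ₂)
  standardBaerSubline P =
    ∃₂ λ a b → a ∈ 𝔽q × b ∈ 𝔽q × coords P ∼ ⟨ a , b , 0# ⟩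

  IsBaerSubline : Pred Point a → Set (c ⊔ ℓ₁ ⊔ ℓ₂ ⊔ a)
  IsBaerSubline = ProjectivelyEquivalent standardBaerSubline

  -- V must be off the line n containing the subline S, for otherwise the
  -- joins of V to the points of S are not q + 1 distinct lines.
  IsBaerPencil : Point → Pred Line (c ⊔ ℓ₁ ⊔ ℓ₂) → Set (Level.suc (c ⊔ ℓ₁ ⊔ ℓ₂))
  IsBaerPencil V 𝓛 =
    ∃ λ (S : Pred Point (c ⊔ ℓ₁ ⊔ ℓ₂)) → IsBaerSubline S
      × (∃ λ n → (∀ X → X ∈ S → X I n) × ¬ (V I n))
      × 𝓛 ≐ (λ m → V I m × ∃ λ X → X ∈ S × X I m)

{-# OPTIONS --safe #-}
module Submission where

open import Algebra.Apartness.Bundles using (HeytingField; HeytingCommutativeRing)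
open import Algebra.Bundles using (CommutativeRing)
import Algebra.Apartness.Properties.HeytingCommutativeRing as HCRProperties
import Algebra.Properties.CommutativeMonoid.Sum as CommutativeMonoidSum
import Algebra.Properties.CommutativeSemiring.Exp as Exp
import Algebra.Properties.Ring as RingProperties
import Algebra.Properties.Semiring.Mult as Mult
import Algebra.Properties.Semiring.Sum as Sum
import Algebra.Solver.Ring as RingSolver
open import Algebra.Solver.Ring.AlmostCommutativeRing
  using (fromCommutativeRing; _-Raw-AlmostCommutative⟶_)
open import Data.Bool.Base using (Bool; true; false; if_then_else_)
open import Data.Bool.Properties using (xor-∧-commutativeRing)
open import Data.Empty using (⊥; ⊥-elim)
open import Data.Fin.Base using (Fin; zero; suc; toℕ; punchIn)
open import Data.Fin.Patterns using (0F; 1F; 2F)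
open import Data.Fin.Permutation using (Permutation′; permutation; _⟨$⟩ʳ_)
import Data.Fin.Properties as Fin
open import Data.Maybe.Base using (Maybe; just; nothing)
open import Data.Nat.Base as ℕ using (ℕ; zero; suc; _≤_; _^_)
import Data.Nat.Properties as ℕ
open import Data.Product.Base using (∃; ∃₂; _×_; _,_; proj₁; proj₂)
open import Data.Sum.Base using (_⊎_; inj₁; inj₂; [_,_]′) renaming (map to ⊎-map)
open import Data.Vec.Functional using (Vector; []; _∷_)
open import Function.Bundles using (Inverse; _⇔_; mk⇔; Equivalence)
open import Level using (_⊔_)
open import Relation.Binary.PropositionalEquality.Core as ≡ using (_≡_)
import Relation.Binary.Reasoning.Setoid as SetoidReasoning
open import Relation.Nullary.Decidable using (Dec; yes; no; map′; decidable-stable)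
open import Relation.Nullary.Negation using (¬_; contradiction)
open import Relation.Unary using (Pred; _∈_; _∉_; _≐_)
open import Defs

-- Write x̄ = x^q, δ = β + β̄ and f(x) = αx² + ᾱx̄² + δxx̄, so that the affine points of the unital are
-- those with y + ȳ = f(x).  The trace condition says that f is anisotropic over 𝔽q, and this forces
-- the tangent at (x₀,y₀) to have slope δx̄₀.  The feet of (a,b) are therefore the points
-- (a + e, b + δāe + δeē) with f(e) = b + b̄ + f(a).  Since δeē ∈ 𝔽q, they lie on the lines of a Baer
-- pencil with vertex (1,δā,0), and a line containing three of them would give a quadratic equation
-- with three roots, provided α ≠ 0.  If α = 0, the unital is projectively a Hermitian curve.
--
-- An arbitrary collineation φ fixing ℓ∞ is handled through the fundamental theorem of projective
-- geometry: every collineation is a field automorphism followed by a projectivity, and a field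
-- automorphism preserves 𝔽q and the Hermitian form.

-- In characteristic 2 the terms αx² and ᾱx̄² are additive, so the polar form of f is δ(xē + x̄e),
-- free of α. Hence the slope δx̄₀ and the shape of the feet are those of a Hermitian curve, and α
-- enters only through the condition f(e) = b + b̄ + f(a). If α = 0, this condition fixes eē and
-- puts all the feet on one line of slope δā. If α ≠ 0, a line of slope δā still fixes eē, but then
-- f(e) leaves at most two feet on it; this is where non-classicality is spent.
--
-- Both conclusions pass to subsets, so it is enough to show that each point of the pedal has the
-- shape of a foot.
--
-- The obstacle is φ, an incidence-preserving bijection, whereas `IsClassical` and `IsBaerSubline`
-- ask for matrices. Once a collineation is split into an automorphism σ and a projectivity g, the
-- Hermitian curve and the standard Baer subline are mapped to themselves by σ, so that g alone
-- carries them to the required place. The same splitting yields preimages of lines.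

-- Fields of finite order

module FiniteField {c ℓ₁ ℓ₂ n} (K : HeytingField c ℓ₁ ℓ₂) (ord : HasOrder K n) where

  open HeytingField K hiding (zero)
  open HeytingCommutativeRing heytingCommutativeRing using (commutativeRing)
  open CommutativeRing commutativeRing
    using (ring; semiring; commutativeSemiring; +-commutativeMonoid; *-commutativeMonoid)
  open HCRProperties heytingCommutativeRing using (1#0; invertibleˡ⇒#; x-0≈x)
  open RingProperties ring using (+-cancelˡ)
  open Mult semiring using () renaming (_×_ to _·_)
  open Exp commutativeSemiring using () renaming (_^_ to _^′_)
  open Inverse ord using (to; from; to-cong; strictlyInverseˡ; strictlyInverseʳ)
  module ∑ = CommutativeMonoidSum +-commutativeMonoid
  module ∏ = CommutativeMonoidSum *-commutativeMonoid
  open SetoidReasoning setoid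

  infix 4 _≟_ _≉_
  _≉_ : Carrier → Carrier → Set ℓ₁
  x ≉ y = ¬ (x ≈ y)

  index-injective : ∀ {x y} → to x ≡ to y → x ≈ y
  index-injective {x} {y} e =
    trans (sym (strictlyInverseʳ x)) (trans (reflexive (≡.cong from e)) (strictlyInverseʳ y))

  _≟_ : ∀ x y → Dec (x ≈ y)
  x ≟ y = map′ index-injective to-cong (to x Fin.≟ to y)

  #0⇒inverse : ∀ {x} → x # 0# → ∃ λ y → x * y ≈ 1#
  #0⇒inverse {x} x#0 with #⇒invertible x#0
  ... | y , _ , e = y , trans (*-congʳ (sym (x-0≈x x))) e

  inverse⇒#0 : ∀ {x y} → x * y ≈ 1# → x # 0#
  inverse⇒#0 {x} {y} e = invertibleˡ⇒# (y , trans (*-congˡ (x-0≈x x)) (trans (*-comm y x) e))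

  #0⇒≉0 : ∀ {x} → x # 0# → x ≉ 0#
  #0⇒≉0 x#0 x≈0 = proj₂ (tight _ _) x≈0 x#0

  -- An inverse is found by exhaustive search; if there is none, tightness gives x ≈ 0.
  ≉0⇒inverse : ∀ {x} → x ≉ 0# → ∃ λ y → x * y ≈ 1#
  ≉0⇒inverse {x} x≉0 with Fin.any? (λ i → x * from i ≟ 1#)
  ... | yes (i , e) = from i , e
  ... | no none = contradiction
    (proj₁ (tight _ _) λ x#0 → let y , e = #0⇒inverse x#0 in
      none (to y , trans (*-congˡ (strictlyInverseʳ y)) e))
    x≉0

  ≉0⇒#0 : ∀ {x} → x ≉ 0# → x # 0#
  ≉0⇒#0 x≉0 = inverse⇒#0 (proj₂ (≉0⇒inverse x≉0))

  1≉0 : 1# ≉ 0#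
  1≉0 = #0⇒≉0 1#0

  *-cancelˡ : ∀ {x y z} → x ≉ 0# → x * y ≈ x * z → y ≈ z
  *-cancelˡ {x} {y} {z} x≉0 e with ≉0⇒inverse x≉0
  ... | w , xw≈1 = begin
    y            ≈⟨ undo y ⟨
    w * (x * y)  ≈⟨ *-congˡ e ⟩
    w * (x * z)  ≈⟨ undo z ⟩
    z            ∎
    where
    undo : ∀ t → w * (x * t) ≈ t
    undo t = trans (sym (*-assoc w x t)) (trans (*-congʳ (trans (*-comm w x) xw≈1)) (*-identityˡ t))

  *-≈0 : ∀ {x y} → x ≉ 0# → x * y ≈ 0# → y ≈ 0#
  *-≈0 {x} x≉0 e = *-cancelˡ x≉0 (trans e (sym (zeroʳ x)))

  *-≉0 : ∀ {x y} → x ≉ 0# → y ≉ 0# → x * y ≉ 0#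
  *-≉0 x≉0 y≉0 e = y≉0 (*-≈0 x≉0 e)

  bijection⇒permutation : (f g : Carrier → Carrier) →
    (∀ {x y} → x ≈ y → f x ≈ f y) → (∀ {x y} → x ≈ y → g x ≈ g y) →
    (∀ x → f (g x) ≈ x) → (∀ x → g (f x) ≈ x) → Permutation′ n
  bijection⇒permutation f g f-cong g-cong fg gf =
    permutation (λ i → to (f (from i))) (λ i → to (g (from i)))
      (λ i → ≡.trans (to-cong (trans (f-cong (strictlyInverseʳ _)) (fg _))) (strictlyInverseˡ i))
      (λ i → ≡.trans (to-cong (trans (g-cong (strictlyInverseʳ _)) (gf _))) (strictlyInverseˡ i))

  -- Translation by 1 permutes the field, so it does not change the sum of all elements.
  order·1≈0 : n · 1# ≈ 0#
  order·1≈0 = +-cancelˡ S _ _ (begin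
    S + n · 1#                                   ≈⟨ +-congˡ (∑.sum-replicate n) ⟨
    S + ∑.sum {n} (λ _ → 1#)                     ≈⟨ ∑.∑-distrib-+ from (λ _ → 1#) ⟨
    ∑.sum (λ i → from i + 1#)                    ≈⟨ ∑.sum-cong-≋ {n} (λ i →
       strictlyInverseʳ (from i + 1#)) ⟨
    ∑.sum (λ i → from (to (from i + 1#)))        ≈⟨ ∑.sum-permute from π ⟨
    S                                            ≈⟨ +-identityʳ S ⟨
    S + 0#                                       ∎)
    where
    S = ∑.sum from
    π = bijection⇒permutation (_+ 1#) (_- 1#) +-congʳ +-congʳ
      (λ x → trans (+-assoc _ _ _) (trans (+-congˡ (-‿inverseˡ 1#)) (+-identityʳ x)))
      (λ x → trans (+-assoc _ _ _) (trans (+-congˡ (-‿inverseʳ 1#)) (+-identityʳ x)))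

  ∏-≉0 : ∀ {m} (f : Vector Carrier m) → (∀ i → f i ≉ 0#) → ∏.sum f ≉ 0#
  ∏-≉0 {zero}  f f≉0 = 1≉0
  ∏-≉0 {suc m} f f≉0 = *-≉0 (f≉0 zero) (∏-≉0 (λ i → f (suc i)) (λ i → f≉0 (suc i)))

  -- Only m - 1 factors equal a; the extra factor a on the left avoids the subtraction and yields
  -- the full power.
  ∏-except-one : ∀ {m} (i : Fin m) (f : Vector Carrier m) {a} → f i ≈ 1# →
    (∀ j → ¬ (j ≡ i) → f j ≈ a) → a * ∏.sum f ≈ a ^′ m
  ∏-except-one {suc m} i f fi fj = *-congˡ (trans (∏.sum-remove {i = i} f)
    (trans (*-congʳ fi) (trans (*-identityˡ _) (trans
      (∏.sum-cong-≋ (λ j → fj (punchIn i j) (Fin.punchInᵢ≢i i j)))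
      (∏.sum-replicate m)))))

  -- Puts 1 in place of the factor at x = 0, so that a product over the whole field counts only the
  -- nonzero elements.
  or1 : Carrier → Carrier → Carrier
  or1 x y with x ≟ 0#
  ... | yes _ = 1#
  ... | no  _ = y

  or1-≈0 : ∀ {x} y → x ≈ 0# → or1 x y ≈ 1#
  or1-≈0 {x} y x≈0 with x ≟ 0#
  ... | yes _   = refl
  ... | no x≉0 = contradiction x≈0 x≉0

  or1-≉0 : ∀ {x} y → x ≉ 0# → or1 x y ≈ y
  or1-≉0 {x} y x≉0 with x ≟ 0#
  ... | yes x≈0 = contradiction x≈0 x≉0
  ... | no _    = refl

  -- Scaling by a permutes the field, so it does not change the product of the nonzero elements.
  fermat : ∀ a → a ^′ n ≈ a
  fermat a with a ≟ 0#
  ... | yes a≈0 = trans (Exp.^-congˡ commutativeSemiring n a≈0)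
                    (trans (0^ (to 0#)) (sym a≈0))
    where
    -- The index of 0 witnesses that n is positive; for n = 0 the power would be 1.
    0^ : ∀ {m} → Fin m → 0# ^′ m ≈ 0#
    0^ {suc m} _ = zeroˡ _
  ... | no a≉0 with ≉0⇒inverse a≉0
  ... | a⁻¹ , aa⁻¹≈1 = trans
    (sym (∏-except-one (to 0#) (λ i → or1 (from i) a) (or1-≈0 a (strictlyInverseʳ 0#))
      (λ i i≢ → or1-≉0 a λ e → i≢ (≡.trans (≡.sym (strictlyInverseˡ i)) (to-cong e)))))
    (trans (*-congˡ ∏or1≈1) (*-identityʳ a))
    where
    π = bijection⇒permutation (a *_) (a⁻¹ *_) *-congˡ *-congˡ
      (λ x → trans (sym (*-assoc _ _ _)) (trans (*-congʳ aa⁻¹≈1) (*-identityˡ x)))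
      (λ x → trans (sym (*-assoc _ _ _))
               (trans (*-congʳ (trans (*-comm _ _) aa⁻¹≈1)) (*-identityˡ x)))
    P : Vector Carrier n
    P i = or1 (from i) (from i)
    P≉0 : ∀ i → P i ≉ 0#
    P≉0 i e with from i ≟ 0#
    ... | yes _ = 1≉0 e
    ... | no x≉0 = x≉0 e
    scale : ∀ i → P (π ⟨$⟩ʳ i) ≈ P i * or1 (from i) a
    scale i with from i ≟ 0#
    ... | yes x≈0 = trans
            (or1-≈0 _ (trans (strictlyInverseʳ _) (trans (*-congˡ x≈0) (zeroʳ a))))
            (sym (*-identityˡ 1#))
    ... | no x≉0 = trans
            (or1-≉0 _ (λ e → *-≉0 a≉0 x≉0 (trans (sym (strictlyInverseʳ _)) e)))
            (trans (strictlyInverseʳ _) (*-comm _ _))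
    ∏or1≈1 : ∏.sum (λ i → or1 (from i) a) ≈ 1#
    ∏or1≈1 = *-cancelˡ (∏-≉0 P P≉0) (begin
      ∏.sum P * ∏.sum (λ i → or1 (from i) a)      ≈⟨ ∏.∑-distrib-+ P (λ i → or1 (from i) a) ⟨
      ∏.sum (λ i → P i * or1 (from i) a)          ≈⟨ ∏.sum-cong-≋ scale ⟨
      ∏.sum (λ i → P (π ⟨$⟩ʳ i))                  ≈⟨ ∏.sum-permute P π ⟨
      ∏.sum P                                     ≈⟨ *-identityʳ _ ⟨
      ∏.sum P * 1#                                ∎)

-- Characteristic 2, conjugation over 𝔽q and the absolute trace

module EvenField {c ℓ₁ ℓ₂} (h : ℕ) (K : HeytingField c ℓ₁ ℓ₂) (ord : HasOrder K ((2 ^ h) ^ 2)) where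

  open Plane h K using (q; Tr)
  open HeytingField K hiding (zero)
  open HeytingCommutativeRing heytingCommutativeRing using (commutativeRing)
  open CommutativeRing commutativeRing using (ring; semiring; commutativeSemiring)
  open RingProperties ring using (+-cancelʳ)
  open Mult semiring using (×1-homo-*) renaming (_×_ to _·_)
  open Exp commutativeSemiring using (^-congˡ; ^-homo-*; ^-assocʳ; ^-distrib-*) renaming (_^_ to _^′_)
  open Sum semiring using (sum; sum-cong-≋)
  open FiniteField K ord public
  open SetoidReasoning setoid

  -- The order n is a power of 2 and n · 1 = 0, so a power of 2 · 1 vanishes, and a field has no
  -- nonzero nilpotents.
  1+1≈0 : 1# + 1# ≈ 0#
  1+1≈0 = trans (+-congˡ (sym (+-identityʳ 1#))) (even (h ℕ.* 2)
    (trans (reflexive (≡.cong (_· 1#) (≡.sym (ℕ.^-*-assoc 2 h 2)))) order·1≈0))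
    where
    even : ∀ k → (2 ^ k) · 1# ≈ 0# → 2 · 1# ≈ 0#
    even zero e = contradiction (trans (sym (+-identityʳ 1#)) e) 1≉0
    even (suc k) e with (2 · 1#) ≟ 0#
    ... | yes 2≈0 = 2≈0
    ... | no 2≉0 = even k (*-≈0 2≉0 (trans (sym (×1-homo-* 2 (2 ^ k))) e))

  private
    A = fromCommutativeRing commutativeRing

    morphism : CommutativeRing.rawRing xor-∧-commutativeRing -Raw-AlmostCommutative⟶ A
    morphism = record
      { ⟦_⟧ = λ b → if b then 1# else 0#
      ; +-homo = λ { true true → sym 1+1≈0 ; true false → sym (+-identityʳ _)
                   ; false y → sym (+-identityˡ _) }
      ; *-homo = λ { true y → sym (*-identityˡ _) ; false y → sym (zeroˡ _) }
      ; -‿homo = λ { true → trans (sym (+-identityʳ _)) (trans (+-congˡ (sym (-‿inverseʳ 1#)))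
                       (trans (sym (+-assoc _ _ _)) (trans (+-congʳ 1+1≈0) (+-identityˡ _))))
                   ; false → sym (RingProperties.-0#≈0# ring) }
      ; 0-homo = refl
      ; 1-homo = refl
      }

    _coeff≟_ : ∀ a b → Maybe ((if a then 1# else 0#) ≈ (if b then 1# else 0#))
    true  coeff≟ true  = just refl
    true  coeff≟ false = nothing
    false coeff≟ true  = nothing
    false coeff≟ false = just refl

  open RingSolver _ A morphism _coeff≟_ public using (solve; _:=_; _:+_; _:*_; con; Polynomial)

  :0 :1 : ∀ {m} → Polynomial m
  :0 = con false
  :1 = con true

  x+x≈0 : ∀ x → x + x ≈ 0#
  x+x≈0 = solve 1 (λ x → x :+ x := :0) refl

  ≈⇒+≈0 : ∀ {x y} → x ≈ y → x + y ≈ 0#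
  ≈⇒+≈0 {x} {y} e = trans (+-congʳ e) (x+x≈0 y)

  +≈0⇒≈ : ∀ {x y} → x + y ≈ 0# → x ≈ y
  +≈0⇒≈ {x} {y} e = +-cancelʳ y x y (trans e (sym (x+x≈0 y)))

  -- The pattern for deriving equations: x is written as a linear combination of quantities known to
  -- vanish, and the ring solver checks that identity, from which coefficients given as `_` are
  -- inferred.
  combination₁ : ∀ {x} c {u} → u ≈ 0# → x ≈ c * u → x ≈ 0#
  combination₁ c u≈0 e = trans e (trans (*-congˡ u≈0) (zeroʳ c))

  combination₂ : ∀ {x} c {u} d {v} → u ≈ 0# → v ≈ 0# → x ≈ c * u + d * v → x ≈ 0#
  combination₂ c d u≈0 v≈0 e = trans e (trans
    (+-cong (combination₁ c u≈0 refl) (combination₁ d v≈0 refl)) (+-identityʳ 0#))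

  combination₃ : ∀ {x} c {u} d {v} e {w} → u ≈ 0# → v ≈ 0# → w ≈ 0# →
    x ≈ c * u + d * v + e * w → x ≈ 0#
  combination₃ c d e u≈0 v≈0 w≈0 eq = trans eq (trans
    (+-cong (combination₂ c d u≈0 v≈0 refl) (combination₁ e w≈0 refl)) (+-identityʳ 0#))

  -- Two distinct roots have sum c. If x differs from both y and z, these are therefore both x + c.
  quadratic-roots : ∀ {c d x y z} → x * x + c * x ≈ d → y * y + c * y ≈ d → z * z + c * z ≈ d →
    x ≈ y ⊎ x ≈ z ⊎ y ≈ z
  quadratic-roots {c} {d} {x} {y} {z} ex ey ez with (x + y) ≟ 0# | (x + z) ≟ 0#
  ... | yes e | _     = inj₁ (+≈0⇒≈ e)
  ... | no _  | yes e = inj₂ (inj₁ (+≈0⇒≈ e))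
  ... | no x≉y | no x≉z = inj₂ (inj₂ (+≈0⇒≈ (trans
    (solve 4 (λ c x y z → y :+ z := (x :+ y :+ c) :+ (x :+ z :+ c)) refl c x y z)
    (trans (+-cong (other-root x≉y ey) (other-root x≉z ez)) (+-identityʳ 0#)))))
    where
    other-root : ∀ {y} → x + y ≉ 0# → y * y + c * y ≈ d → x + y + c ≈ 0#
    other-root {y} x≉y ey = *-≈0 x≉y (trans
      (solve 3 (λ c x y → (x :+ y) :* (x :+ y :+ c) := (x :* x :+ c :* x) :+ (y :* y :+ c :* y))
        refl c x y)
      (≈⇒+≈0 (trans ex (sym ey))))

  ^2^suc : ∀ x k → x ^′ (2 ^ suc k) ≈ x ^′ (2 ^ k) * x ^′ (2 ^ k)
  ^2^suc x k = trans (^-homo-* x (2 ^ k) _)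
    (*-congˡ (reflexive (≡.cong (x ^′_) (ℕ.+-identityʳ (2 ^ k)))))

  ^2^-+ : ∀ x y k → (x + y) ^′ (2 ^ k) ≈ x ^′ (2 ^ k) + y ^′ (2 ^ k)
  ^2^-+ x y zero = solve 2 (λ x y → (x :+ y) :* :1 := x :* :1 :+ y :* :1) refl x y
  ^2^-+ x y (suc k) = begin
    (x + y) ^′ (2 ^ suc k)                              ≈⟨ ^2^suc (x + y) k ⟩
    (x + y) ^′ (2 ^ k) * (x + y) ^′ (2 ^ k)             ≈⟨ *-cong (^2^-+ x y k) (^2^-+ x y k) ⟩
    (u + v) * (u + v)                                   ≈⟨ solve 2 (λ u v →
      (u :+ v) :* (u :+ v) := u :* u :+ v :* v) refl u v ⟩
    u * u + v * v                                       ≈⟨ +-cong (^2^suc x k) (^2^suc y k) ⟨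
    x ^′ (2 ^ suc k) + y ^′ (2 ^ suc k)                 ∎
    where
    u = x ^′ (2 ^ k)
    v = y ^′ (2 ^ k)

  x^2≈xx : ∀ x → x ^′ 2 ≈ x * x
  x^2≈xx x = *-congˡ (*-identityʳ x)

  infix 9 _̄
  _̄ : Carrier → Carrier
  x ̄ = x ^′ q

  bar-cong : ∀ {x y} → x ≈ y → x ̄ ≈ y ̄
  bar-cong = ^-congˡ q

  bar-+ : ∀ x y → (x + y) ̄ ≈ x ̄ + y ̄
  bar-+ x y = ^2^-+ x y h

  bar-* : ∀ x y → (x * y) ̄ ≈ x ̄ * y ̄
  bar-* x y = ^-distrib-* x y q

  bar-involutive : ∀ x → (x ̄) ̄ ≈ x
  bar-involutive x = trans (^-assocʳ x q q)
    (trans (reflexive (≡.cong (λ m → x ^′ (q ℕ.* m)) (≡.sym (ℕ.*-identityʳ q)))) (fermat x))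

  bar-1 : 1# ̄ ≈ 1#
  bar-1 = 1^ q
    where
    1^ : ∀ m → 1# ^′ m ≈ 1#
    1^ zero = refl
    1^ (suc m) = trans (*-identityˡ _) (1^ m)

  bar-0 : 0# ̄ ≈ 0#
  bar-0 = +-cancelʳ (0# ̄) _ _ (trans (sym (bar-+ 0# 0#))
    (trans (bar-cong (+-identityʳ 0#)) (sym (+-identityˡ _))))

  bar-≉0 : ∀ {x} → x ≉ 0# → x ̄ ≉ 0#
  bar-≉0 x≉0 e = x≉0 (trans (sym (bar-involutive _)) (trans (bar-cong e) bar-0))

  ^[q+1] : ∀ x → x ^′ (q ℕ.+ 1) ≈ x ̄ * x
  ^[q+1] x = trans (^-homo-* x q 1) (*-congˡ (*-identityʳ x))

  norm∈𝔽q : ∀ x → (x * x ̄) ̄ ≈ x * x ̄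
  norm∈𝔽q x = trans (bar-* _ _) (trans (*-congˡ (bar-involutive x)) (*-comm _ _))

  sum-telescopes : ∀ m (u : ℕ → Carrier) →
    sum {m} (λ i → u (suc (toℕ i)) + u (toℕ i)) ≈ u m + u 0
  sum-telescopes zero u = sym (x+x≈0 (u 0))
  sum-telescopes (suc m) u = trans (+-congˡ (sum-telescopes m (λ i → u (suc i))))
    (solve 3 (λ x y z → (y :+ z) :+ (x :+ y) := x :+ z) refl (u (suc m)) (u 1) (u 0))

  -- The sum telescopes. Since s may lie outside 𝔽q, the value s̄ + s need not be 0: the trace of t
  -- detects whether a root s of S² + S = t belongs to 𝔽q.
  Tr-artin-schreier : ∀ {s t} → s * s + s ≈ t → Tr t ≈ s ̄ + s
  Tr-artin-schreier {s} {t} e = begin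
    Tr t                                                  ≈⟨ sum-cong-≋ {h} (λ i → term (toℕ i)) ⟩
    sum {h} (λ i → s ^′ (2 ^ suc (toℕ i)) + s ^′ (2 ^ toℕ i)) ≈⟨ sum-telescopes h (λ i → s ^′ (2 ^ i)) ⟩
    s ̄ + s ^′ 1                                          ≈⟨ +-congˡ (*-identityʳ s) ⟩
    s ̄ + s                                               ∎
    where
    term : ∀ k → t ^′ (2 ^ k) ≈ s ^′ (2 ^ suc k) + s ^′ (2 ^ k)
    term k = begin
      t ^′ (2 ^ k)                                 ≈⟨ ^-congˡ (2 ^ k) e ⟨
      (s * s + s) ^′ (2 ^ k)                       ≈⟨ ^2^-+ (s * s) s k ⟩
      (s * s) ^′ (2 ^ k) + s ^′ (2 ^ k)            ≈⟨ +-congʳ (^-distrib-* s s (2 ^ k)) ⟩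
      s ^′ (2 ^ k) * s ^′ (2 ^ k) + s ^′ (2 ^ k)   ≈⟨ +-congʳ (^2^suc s k) ⟨
      s ^′ (2 ^ suc k) + s ^′ (2 ^ k)              ∎

-- Homogeneous coordinates and projectivities

module ProjectivePlane {c ℓ₁ ℓ₂} (h : ℕ) (K : HeytingField c ℓ₁ ℓ₂) (ord : HasOrder K ((2 ^ h) ^ 2)) where

  open Plane h K
  open HeytingField K hiding (zero)
  open HeytingCommutativeRing heytingCommutativeRing using (commutativeRing)
  open CommutativeRing commutativeRing using (commutativeSemiring)
  open HCRProperties heytingCommutativeRing using (1#0; x#0y#0→xy#0)
  open Exp commutativeSemiring using () renaming (_^_ to _^′_)
  open EvenField h K ord public
  open SetoidReasoning setoid

  -- The trailing `0#` makes this agree definitionally with the sums in `_I_` and `_*ᵥ_`.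
  dot : Triple → Triple → Carrier
  dot m v = (m 0F) * (v 0F) + ((m 1F) * (v 1F) + ((m 2F) * (v 2F) + 0#))

  cross : Triple → Triple → Triple
  cross u v = ⟨ u 1F * v 2F + u 2F * v 1F , u 2F * v 0F + u 0F * v 2F , u 0F * v 1F + u 1F * v 0F ⟩

  det : Triple → Triple → Triple → Carrier
  det u v w = dot (cross u v) w

  :dot : ∀ {m} (a b c x y z : Polynomial m) → Polynomial m
  :dot a b c x y z = a :* x :+ (b :* y :+ (c :* z :+ :0))

  :det : ∀ {m} (a b c x y z u v w : Polynomial m) → Polynomial m
  :det a b c x y z u v w = :dot (b :* z :+ c :* y) (c :* x :+ a :* z) (a :* y :+ b :* x) u v w

  e₁ e₂ e₃ e₄ : Triple
  e₁ = ⟨ 1# , 0# , 0# ⟩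
  e₂ = ⟨ 0# , 1# , 0# ⟩
  e₃ = ⟨ 0# , 0# , 1# ⟩
  e₄ = ⟨ 1# , 1# , 1# ⟩

  dot-e₁ : ∀ m → dot m e₁ ≈ m 0F
  dot-e₁ m = solve 3 (λ a b c → :dot a b c :1 :0 :0 := a) refl (m 0F) (m 1F) (m 2F)

  dot-e₂ : ∀ m → dot m e₂ ≈ m 1F
  dot-e₂ m = solve 3 (λ a b c → :dot a b c :0 :1 :0 := b) refl (m 0F) (m 1F) (m 2F)

  dot-e₃ : ∀ m → dot m e₃ ≈ m 2F
  dot-e₃ m = solve 3 (λ a b c → :dot a b c :0 :0 :1 := c) refl (m 0F) (m 1F) (m 2F)

  dot-cong : ∀ {m m′ v v′ : Triple} → (∀ i → m i ≈ m′ i) → (∀ i → v i ≈ v′ i) → dot m v ≈ dot m′ v′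
  dot-cong e f = +-cong (*-cong (e 0F) (f 0F)) (+-cong (*-cong (e 1F) (f 1F))
    (+-congʳ (*-cong (e 2F) (f 2F))))

  dot-congˡ : ∀ {m n : Triple} v → (∀ i → m i ≈ n i) → dot m v ≈ dot n v
  dot-congˡ {m} {n} v e = dot-cong {m} {n} {v} e (λ _ → refl)

  dot-congʳ : ∀ m {u v : Triple} → (∀ i → u i ≈ v i) → dot m u ≈ dot m v
  dot-congʳ m {u} {v} e = dot-cong {m} {m} {u} {v} (λ _ → refl) e

  dot-zeroˡ : ∀ v → dot (λ _ → 0#) v ≈ 0#
  dot-zeroˡ v = solve 3 (λ a b c → :dot :0 :0 :0 a b c := :0) refl (v 0F) (v 1F) (v 2F)

  dot-zeroʳ : ∀ m → dot m (λ _ → 0#) ≈ 0#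
  dot-zeroʳ m = solve 3 (λ a b c → :dot a b c :0 :0 :0 := :0) refl (m 0F) (m 1F) (m 2F)

  dot-scale : ∀ m k v → dot m (λ i → k * v i) ≈ k * dot m v
  dot-scale m k v = solve 7 (λ a b c k x y z →
    :dot a b c (k :* x) (k :* y) (k :* z) := k :* :dot a b c x y z) refl
    (m 0F) (m 1F) (m 2F) k (v 0F) (v 1F) (v 2F)

  dot-comm : ∀ m v → dot m v ≈ dot v m
  dot-comm m v = solve 6 (λ a b c x y z → :dot a b c x y z := :dot x y z a b c) refl
    (m 0F) (m 1F) (m 2F) (v 0F) (v 1F) (v 2F)

  -- With the next three: no three of the points e₁, e₂, e₃, e₄ are collinear, so they form a frame.
  det-e₁₂₃ : det e₁ e₂ e₃ ≈ 1#
  det-e₁₂₃ = solve 0 (:det :1 :0 :0 :0 :1 :0 :0 :0 :1 := :1) refl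

  det-e₄₂₃ : det e₄ e₂ e₃ ≈ 1#
  det-e₄₂₃ = solve 0 (:det :1 :1 :1 :0 :1 :0 :0 :0 :1 := :1) refl

  det-e₁₄₃ : det e₁ e₄ e₃ ≈ 1#
  det-e₁₄₃ = solve 0 (:det :1 :0 :0 :1 :1 :1 :0 :0 :1 := :1) refl

  det-e₁₂₄ : det e₁ e₂ e₄ ≈ 1#
  det-e₁₂₄ = solve 0 (:det :1 :0 :0 :0 :1 :0 :1 :1 :1 := :1) refl

  det-left : ∀ u v → det u v u ≈ 0#
  det-left u v = solve 6 (λ a b c x y z → :det a b c x y z a b c := :0) refl
    (u 0F) (u 1F) (u 2F) (v 0F) (v 1F) (v 2F)

  det-right : ∀ u v → det u v v ≈ 0#
  det-right u v = solve 6 (λ a b c x y z → :det a b c x y z x y z := :0) refl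
    (u 0F) (u 1F) (u 2F) (v 0F) (v 1F) (v 2F)

  NonZero : Triple → Set ℓ₁
  NonZero v = ∃ λ i → v i ≉ 0#

  nonZero? : ∀ v → NonZero v ⊎ (∀ i → v i ≈ 0#)
  nonZero? v with Fin.all? (λ i → v i ≟ 0#)
  ... | yes v≈0 = inj₂ v≈0
  ... | no v≉0 = inj₁ (Fin.¬∀⟶∃¬ 3 _ (λ i → v i ≟ 0#) v≉0)

  point : ∀ v → NonZero v → Point
  point v (i , vi≉0) = v , i , ≉0⇒#0 vi≉0

  coords-nonZero : ∀ P → NonZero (coords P)
  coords-nonZero (_ , i , vi#0) = i , #0⇒≉0 vi#0

  nonZero-⊥ : ∀ v → NonZero v → v 0F ≈ 0# → v 1F ≈ 0# → v 2F ≈ 0# → ⊥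
  nonZero-⊥ v (0F , e) e₀ e₁ e₂ = e e₀
  nonZero-⊥ v (1F , e) e₀ e₁ e₂ = e e₁
  nonZero-⊥ v (2F , e) e₀ e₁ e₂ = e e₂

  ∼-refl : ∀ {u} → u ∼ u
  ∼-refl = 1# , 1#0 , λ i → *-identityˡ _

  ∼-reflexive : ∀ {u v} → (∀ i → u i ≈ v i) → u ∼ v
  ∼-reflexive e = 1# , 1#0 , λ i → trans (*-identityˡ _) (e i)

  ∼-trans : ∀ {u v w} → u ∼ v → v ∼ w → u ∼ w
  ∼-trans (k , k#0 , e) (l , l#0 , f) =
    l * k , x#0y#0→xy#0 l#0 k#0 , λ i → trans (*-assoc _ _ _) (trans (*-congˡ (e i)) (f i))

  ∼-sym : ∀ {u v} → u ∼ v → v ∼ u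
  ∼-sym (k , k#0 , e) with ≉0⇒inverse (#0⇒≉0 k#0)
  ... | l , kl≈1 = l , inverse⇒#0 (trans (*-comm l k) kl≈1) , λ i → trans (*-congˡ (sym (e i)))
    (trans (sym (*-assoc l k _)) (trans (*-congʳ (trans (*-comm l k) kl≈1)) (*-identityˡ _)))

  ∼-≉0 : ∀ {u v} i → u ∼ v → u i ≉ 0# → v i ≉ 0#
  ∼-≉0 i (k , k#0 , e) ui≉0 vi≈0 = *-≉0 (#0⇒≉0 k#0) ui≉0 (trans (e i) vi≈0)

  dot-∼ : ∀ m {u v} → u ∼ v → dot m u ≈ 0# → dot m v ≈ 0#
  dot-∼ m {u} (k , _ , e) d = trans (dot-congʳ m (λ i → sym (e i)))
    (combination₁ k d (dot-scale m k u))

  dot-∼ˡ : ∀ {m n} v → m ∼ n → dot m v ≈ 0# → dot n v ≈ 0#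
  dot-∼ˡ {m} {n} v m∼n d = trans (dot-comm n v) (dot-∼ v m∼n (trans (dot-comm v m) d))

  -- The 2 × 2 minors vanish, so the triples are proportional. The factor is read off at an index
  -- where u is nonzero, and it is nonzero because v is.
  cross≈0⇒∼ : ∀ u v → NonZero u → NonZero v → (∀ i → cross u v i ≈ 0#) → u ∼ v
  cross≈0⇒∼ u v (i , ui≉0) (j , vj≉0) e with ≉0⇒inverse ui≉0
  ... | w , uw≈1 = v i * w , ≉0⇒#0 k≉0 , scaled
    where
    minors : ∀ i j → u i * v j ≈ u j * v i
    minors 0F 0F = refl
    minors 0F 1F = +≈0⇒≈ (e 2F)
    minors 0F 2F = +≈0⇒≈ (trans (+-comm _ _) (e 1F))
    minors 1F 0F = sym (+≈0⇒≈ (e 2F))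
    minors 1F 1F = refl
    minors 1F 2F = +≈0⇒≈ (e 0F)
    minors 2F 0F = +≈0⇒≈ (e 1F)
    minors 2F 1F = sym (+≈0⇒≈ (e 0F))
    minors 2F 2F = refl
    scaled : ∀ j → v i * w * u j ≈ v j
    scaled j = begin
      v i * w * u j    ≈⟨ solve 3 (λ v w u → v :* w :* u := w :* (u :* v)) refl (v i) w (u j) ⟩
      w * (u j * v i)  ≈⟨ *-congˡ (minors i j) ⟨
      w * (u i * v j)  ≈⟨ solve 3 (λ u w v → w :* (u :* v) := u :* w :* v) refl (u i) w (v j) ⟩
      u i * w * v j    ≈⟨ *-congʳ uw≈1 ⟩
      1# * v j         ≈⟨ *-identityˡ _ ⟩
      v j              ∎
    k≉0 : v i * w ≉ 0#
    k≉0 k≈0 = vj≉0 (trans (sym (scaled j)) (trans (*-congʳ k≈0) (zeroˡ _)))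

  -- The triple product identity (u × v) × m = (m·u) v + (m·v) u, without signs.
  cross-join : ∀ {m u v} → dot m u ≈ 0# → dot m v ≈ 0# → ∀ i → cross (cross u v) m i ≈ 0#
  cross-join {m} {u} {v} mu mv 0F = combination₂ _ _ mu mv (solve 9 (λ m n o a b c x y z →
    (c :* x :+ a :* z) :* o :+ (a :* y :+ b :* x) :* n :=
      x :* :dot m n o a b c :+ a :* :dot m n o x y z) refl
    (m 0F) (m 1F) (m 2F) (u 0F) (u 1F) (u 2F) (v 0F) (v 1F) (v 2F))
  cross-join {m} {u} {v} mu mv 1F = combination₂ _ _ mu mv (solve 9 (λ m n o a b c x y z →
    (a :* y :+ b :* x) :* m :+ (b :* z :+ c :* y) :* o :=
      y :* :dot m n o a b c :+ b :* :dot m n o x y z) refl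
    (m 0F) (m 1F) (m 2F) (u 0F) (u 1F) (u 2F) (v 0F) (v 1F) (v 2F))
  cross-join {m} {u} {v} mu mv 2F = combination₂ _ _ mu mv (solve 9 (λ m n o a b c x y z →
    (b :* z :+ c :* y) :* n :+ (c :* x :+ a :* z) :* m :=
      z :* :dot m n o a b c :+ c :* :dot m n o x y z) refl
    (m 0F) (m 1F) (m 2F) (u 0F) (u 1F) (u 2F) (v 0F) (v 1F) (v 2F))

  join-unique : ∀ m u v → NonZero m → NonZero (cross u v) → dot m u ≈ 0# → dot m v ≈ 0# → cross u v ∼ m
  join-unique m u v m≉0 uv≉0 mu mv = cross≈0⇒∼ (cross u v) m uv≉0 m≉0 (cross-join {m} {u} {v} mu mv)

  infixl 7 _ᵥ*_
  _ᵥ*_ : Triple → Matrix → Triple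
  (m ᵥ* M) j = dot m (λ i → M i j)

  dot-assoc : ∀ m M v → dot m (M *ᵥ v) ≈ dot (m ᵥ* M) v
  dot-assoc m M v = trans
    (+-cong (*-congˡ (dot-comm (M 0F) v)) (+-cong (*-congˡ (dot-comm (M 1F) v))
      (+-congʳ (*-congˡ (dot-comm (M 2F) v)))))
    (solve 15 (λ m n o a b c d e f g h i x y z →
      :dot m n o (:dot x y z a b c) (:dot x y z d e f) (:dot x y z g h i) :=
      :dot (:dot m n o a d g) (:dot m n o b e h) (:dot m n o c f i) x y z) refl
      (m 0F) (m 1F) (m 2F)
      (M 0F 0F) (M 0F 1F) (M 0F 2F) (M 1F 0F) (M 1F 1F) (M 1F 2F) (M 2F 0F) (M 2F 1F) (M 2F 2F)
      (v 0F) (v 1F) (v 2F))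

  *ᵥ-cong : ∀ M {u v} → (∀ i → u i ≈ v i) → ∀ i → (M *ᵥ u) i ≈ (M *ᵥ v) i
  *ᵥ-cong M e i = dot-congʳ (M i) e

  *ᵥ-∼ : ∀ M {u v} → u ∼ v → M *ᵥ u ∼ M *ᵥ v
  *ᵥ-∼ M {u} (k , k#0 , e) =
    k , k#0 , λ i → trans (sym (dot-scale (M i) k u)) (*ᵥ-cong M e i)

  columns : Triple → Triple → Triple → Matrix
  columns u v w i = ⟨ u i , v i , w i ⟩

  columns-projectivity : ∀ u v w → det u v w ≉ 0# → Projectivity
  columns-projectivity u v w D≉0 =
    record { matrix = M ; inverse = N ; inverseˡ = left ; inverseʳ = right }
    where
    k = proj₁ (≉0⇒inverse D≉0)
    Dk≈1 = proj₂ (≉0⇒inverse D≉0)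
    M = columns u v w
    -- The inverse is the adjugate divided by the determinant; its rows are cross products of the
    -- columns.
    cofactors : Matrix
    cofactors = cross v w ∷ cross w u ∷ cross u v ∷ []
    N : Matrix
    N i j = k * cofactors i j
    by-Dk : ∀ {x y} → x ≈ det u v w * k * y → x ≈ y
    by-Dk e = trans e (trans (*-congʳ Dk≈1) (*-identityˡ _))
    left : ∀ x i → (N *ᵥ M *ᵥ x) i ≈ x i
    left x 0F = by-Dk (solve 13 (λ a b c d e f g h i k x y z →
      :dot (k :* (e :* i :+ f :* h)) (k :* (f :* g :+ d :* i)) (k :* (d :* h :+ e :* g))
        (:dot a d g x y z) (:dot b e h x y z) (:dot c f i x y z)
      := :det a b c d e f g h i :* k :* x) refl
      (u 0F) (u 1F) (u 2F) (v 0F) (v 1F) (v 2F) (w 0F) (w 1F) (w 2F) k (x 0F) (x 1F) (x 2F))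
    left x 1F = by-Dk (solve 13 (λ a b c d e f g h i k x y z →
      :dot (k :* (h :* c :+ i :* b)) (k :* (i :* a :+ g :* c)) (k :* (g :* b :+ h :* a))
        (:dot a d g x y z) (:dot b e h x y z) (:dot c f i x y z)
      := :det a b c d e f g h i :* k :* y) refl
      (u 0F) (u 1F) (u 2F) (v 0F) (v 1F) (v 2F) (w 0F) (w 1F) (w 2F) k (x 0F) (x 1F) (x 2F))
    left x 2F = by-Dk (solve 13 (λ a b c d e f g h i k x y z →
      :dot (k :* (b :* f :+ c :* e)) (k :* (c :* d :+ a :* f)) (k :* (a :* e :+ b :* d))
        (:dot a d g x y z) (:dot b e h x y z) (:dot c f i x y z)
      := :det a b c d e f g h i :* k :* z) refl
      (u 0F) (u 1F) (u 2F) (v 0F) (v 1F) (v 2F) (w 0F) (w 1F) (w 2F) k (x 0F) (x 1F) (x 2F))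
    :cofactors : ∀ {m} (a b c d e f g h i k x y z r s t : Polynomial m) → Polynomial m
    :cofactors a b c d e f g h i k x y z r s t = :dot r s t
      (:dot (k :* (e :* i :+ f :* h)) (k :* (f :* g :+ d :* i)) (k :* (d :* h :+ e :* g)) x y z)
      (:dot (k :* (h :* c :+ i :* b)) (k :* (i :* a :+ g :* c)) (k :* (g :* b :+ h :* a)) x y z)
      (:dot (k :* (b :* f :+ c :* e)) (k :* (c :* d :+ a :* f)) (k :* (a :* e :+ b :* d)) x y z)
    right : ∀ x i → (M *ᵥ N *ᵥ x) i ≈ x i
    right x 0F = by-Dk (solve 13 (λ a b c d e f g h i k x y z →
      :cofactors a b c d e f g h i k x y z a d g := :det a b c d e f g h i :* k :* x) refl
      (u 0F) (u 1F) (u 2F) (v 0F) (v 1F) (v 2F) (w 0F) (w 1F) (w 2F) k (x 0F) (x 1F) (x 2F))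
    right x 1F = by-Dk (solve 13 (λ a b c d e f g h i k x y z →
      :cofactors a b c d e f g h i k x y z b e h := :det a b c d e f g h i :* k :* y) refl
      (u 0F) (u 1F) (u 2F) (v 0F) (v 1F) (v 2F) (w 0F) (w 1F) (w 2F) k (x 0F) (x 1F) (x 2F))
    right x 2F = by-Dk (solve 13 (λ a b c d e f g h i k x y z →
      :cofactors a b c d e f g h i k x y z c f i := :det a b c d e f g h i :* k :* z) refl
      (u 0F) (u 1F) (u 2F) (v 0F) (v 1F) (v 2F) (w 0F) (w 1F) (w 2F) k (x 0F) (x 1F) (x 2F))

  _∘ᶜ_ : Collineation → Collineation → Collineation
  φ ∘ᶜ χ = record
    { onPoints = record
      { to = λ P → to φ (to χ P)
      ; from = λ P → from χ (from φ P)
      ; to-cong = λ {P} {Q} e → to-cong φ {to χ P} {to χ Q} (to-cong χ {P} {Q} e)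
      ; from-cong = λ {P} {Q} e → from-cong χ {from φ P} {from φ Q} (from-cong φ {P} {Q} e)
      ; inverse =
          (λ {P} {Q} e → inverseˡ φ {P} {to χ Q} (inverseˡ χ {from φ P} {Q} e)) ,
          (λ {P} {Q} e → inverseʳ χ {P} {from φ Q} (inverseʳ φ {to χ P} {Q} e))
      }
    ; preservesLines = λ m →
        let m′ , m⇔m′ = preservesLines χ m
            m″ , m′⇔m″ = preservesLines φ m′
        in m″ , λ P → mk⇔ (λ i → Equivalence.to (m′⇔m″ _) (Equivalence.to (m⇔m′ P) i))
                          (λ i → Equivalence.from (m⇔m′ P) (Equivalence.from (m′⇔m″ _) i))
    }
    where
    open Collineation using (preservesLines)
    module I ψ = Inverse (Collineation.onPoints ψ)
    open I

  inverseProjectivity : Projectivity → Projectivity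
  inverseProjectivity g = record
    { matrix = inverse ; inverse = matrix ; inverseˡ = inverseʳ ; inverseʳ = inverseˡ }
    where open Projectivity g

  *ᵥ-nonZero : ∀ g {v} → NonZero v → NonZero (Projectivity.matrix g *ᵥ v)
  *ᵥ-nonZero g {v} (i , vi≉0) with nonZero? (Projectivity.matrix g *ᵥ v)
  ... | inj₁ nz = nz
  ... | inj₂ gv≈0 = contradiction vi≈0 vi≉0
    where
    open Projectivity g
    vi≈0 : v i ≈ 0#
    vi≈0 = trans (sym (inverseˡ v i)) (trans (*ᵥ-cong inverse gv≈0 i) (dot-zeroʳ (inverse i)))

  ᵥ*-nonZero : ∀ g {m} → NonZero m → NonZero (m ᵥ* Projectivity.matrix g)
  ᵥ*-nonZero g {m} (i , mi≉0) with nonZero? (m ᵥ* Projectivity.matrix g)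
  ... | inj₁ nz = nz
  ... | inj₂ mg≈0 = ⊥-elim (nonZero-⊥ m (i , mi≉0)
      (trans (sym (dot-e₁ m)) (m⊥ e₁)) (trans (sym (dot-e₂ m)) (m⊥ e₂))
      (trans (sym (dot-e₃ m)) (m⊥ e₃)))
    where
    open Projectivity g
    m⊥ : ∀ v → dot m v ≈ 0#
    m⊥ v = begin
      dot m v                                ≈⟨ dot-congʳ m (inverseʳ v) ⟨
      dot m (matrix *ᵥ inverse *ᵥ v)         ≈⟨ dot-assoc m matrix (inverse *ᵥ v) ⟩
      dot (m ᵥ* matrix) (inverse *ᵥ v)       ≈⟨ dot-congˡ (inverse *ᵥ v) mg≈0 ⟩
      dot (λ _ → 0#) (inverse *ᵥ v)          ≈⟨ dot-zeroˡ (inverse *ᵥ v) ⟩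
      0#                                     ∎

  -- Line coordinates transform contragrediently, hence the inverse matrix acting on the right.
  dot-projectivity : ∀ g m v → let open Projectivity g in dot (m ᵥ* inverse) (matrix *ᵥ v) ≈ dot m v
  dot-projectivity g m v = trans (sym (dot-assoc m inverse (matrix *ᵥ v)))
    (dot-congʳ m (inverseˡ v))
    where open Projectivity g

  projectivityCollineation : Projectivity → Collineation
  projectivityCollineation g = record
    { onPoints = record
      { to = λ P → point (matrix *ᵥ coords P) (*ᵥ-nonZero g (coords-nonZero P))
      ; from = λ P → point (inverse *ᵥ coords P)
          (*ᵥ-nonZero (inverseProjectivity g) (coords-nonZero P))
      ; to-cong = *ᵥ-∼ matrix
      ; from-cong = *ᵥ-∼ inverse
      ; inverse =
          (λ {P} e → ∼-trans (*ᵥ-∼ matrix e) (∼-reflexive (inverseʳ (coords P)))) ,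
          (λ {P} e → ∼-trans (*ᵥ-∼ inverse e) (∼-reflexive (inverseˡ (coords P))))
      }
    ; preservesLines = λ m →
        point (coords m ᵥ* inverse) (ᵥ*-nonZero (inverseProjectivity g) (coords-nonZero m)) ,
        λ P → let e = dot-projectivity g (coords m) (coords P) in
          mk⇔ (trans e) (trans (sym e))
    }
    where open Projectivity g

  columns-e₁ : ∀ u v w i → (columns u v w *ᵥ e₁) i ≈ u i
  columns-e₁ u v w i = dot-e₁ (columns u v w i)

  columns-e₂ : ∀ u v w i → (columns u v w *ᵥ e₂) i ≈ v i
  columns-e₂ u v w i = dot-e₂ (columns u v w i)

  columns-e₃ : ∀ u v w i → (columns u v w *ᵥ e₃) i ≈ w i
  columns-e₃ u v w i = dot-e₃ (columns u v w i)

  scale-∼ : ∀ {k u} → k ≉ 0# → (λ i → k * u i) ∼ u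
  scale-∼ k≉0 = ∼-sym (_ , ≉0⇒#0 k≉0 , λ i → refl)

  cramer : ∀ u v w x i →
    det x v w * u i + (det u x w * v i + det u v x * w i) ≈ det u v w * x i
  cramer u v w x 0F = solve 12 (λ a b c d e f g h i x y z →
    :det x y z d e f g h i :* a :+ (:det a b c x y z g h i :* d :+ :det a b c d e f x y z :* g)
      := :det a b c d e f g h i :* x) refl
    (u 0F) (u 1F) (u 2F) (v 0F) (v 1F) (v 2F) (w 0F) (w 1F) (w 2F) (x 0F) (x 1F) (x 2F)
  cramer u v w x 1F = solve 12 (λ a b c d e f g h i x y z →
    :det x y z d e f g h i :* b :+ (:det a b c x y z g h i :* e :+ :det a b c d e f x y z :* h)
      := :det a b c d e f g h i :* y) refl
    (u 0F) (u 1F) (u 2F) (v 0F) (v 1F) (v 2F) (w 0F) (w 1F) (w 2F) (x 0F) (x 1F) (x 2F)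
  cramer u v w x 2F = solve 12 (λ a b c d e f g h i x y z →
    :det x y z d e f g h i :* c :+ (:det a b c x y z g h i :* f :+ :det a b c d e f x y z :* i)
      := :det a b c d e f g h i :* z) refl
    (u 0F) (u 1F) (u 2F) (v 0F) (v 1F) (v 2F) (w 0F) (w 1F) (w 2F) (x 0F) (x 1F) (x 2F)

  -- The columns are rescaled by Cramer's rule so that their sum is a multiple of x.
  frame-projectivity : ∀ u v w x → det u v w ≉ 0# → det x v w ≉ 0# → det u x w ≉ 0# → det u v x ≉ 0# →
    ∃ λ g → let M = Projectivity.matrix g in
      M *ᵥ e₁ ∼ u × M *ᵥ e₂ ∼ v × M *ᵥ e₃ ∼ w × M *ᵥ e₄ ∼ x
  frame-projectivity u v w x D≉0 a≉0 b≉0 c≉0 = columns-projectivity u′ v′ w′ D′≉0 ,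
    ∼-trans (∼-reflexive (columns-e₁ u′ v′ w′)) (scale-∼ a≉0) ,
    ∼-trans (∼-reflexive (columns-e₂ u′ v′ w′)) (scale-∼ b≉0) ,
    ∼-trans (∼-reflexive (columns-e₃ u′ v′ w′)) (scale-∼ c≉0) ,
    ∼-trans (∼-reflexive (λ i → trans
      (solve 3 (λ a b c → :dot a b c :1 :1 :1 := a :+ (b :+ c)) refl (u′ i) (v′ i) (w′ i))
      (cramer u v w x i))) (scale-∼ D≉0)
    where
    u′ v′ w′ : Triple
    u′ i = det x v w * u i
    v′ i = det u x w * v i
    w′ i = det u v x * w i
    D′≉0 : det u′ v′ w′ ≉ 0#
    D′≉0 e = *-≉0 (*-≉0 a≉0 (*-≉0 b≉0 c≉0)) D≉0 (trans (sym (solve 12 (λ k l m a b c d e f g h i →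
      :det (k :* a) (k :* b) (k :* c) (l :* d) (l :* e) (l :* f) (m :* g) (m :* h) (m :* i)
        := k :* (l :* m) :* :det a b c d e f g h i) refl (det x v w) (det u x w) (det u v x)
      (u 0F) (u 1F) (u 2F) (v 0F) (v 1F) (v 2F) (w 0F) (w 1F) (w 2F))) e)

  det-cross≈0 : ∀ u v w → (∀ i → cross u v i ≈ 0#) → det u v w ≈ 0#
  det-cross≈0 u v w e = trans (dot-congˡ {cross u v} w e) (dot-zeroˡ w)

  ∼⇒cross≈0 : ∀ u v → u ∼ v → ∀ i → cross u v i ≈ 0#
  ∼⇒cross≈0 u v (k , _ , e) = λ where
      0F → minor 1F 2F
      1F → minor 2F 0F
      2F → minor 0F 1F
    where
    minor : ∀ i j → u i * v j + u j * v i ≈ 0#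
    minor i j = trans (+-cong (*-congˡ (sym (e j))) (*-congˡ (sym (e i))))
      (solve 3 (λ k x y → x :* (k :* y) :+ y :* (k :* x) := :0) refl k (u i) (u j))

  -- Collineations and the fundamental theorem

  module CollineationProperties (φ : Collineation) where
    open Inverse (Collineation.onPoints φ) public using (to; from)
    open Collineation φ

    to-∼ : ∀ P Q → coords P ∼ coords Q → coords (to P) ∼ coords (to Q)
    to-∼ P Q = Inverse.to-cong onPoints {P} {Q}

    to∘from : ∀ P → coords (to (from P)) ∼ coords P
    to∘from P = Inverse.strictlyInverseˡ onPoints P

    to-injective : ∀ P Q → coords (to P) ∼ coords (to Q) → coords P ∼ coords Q
    to-injective P Q e = ∼-trans (∼-sym (Inverse.strictlyInverseʳ onPoints P))
      (Inverse.inverseʳ onPoints {Q} {to P} e)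

    -- Suppose the images are collinear. If the images of A and B coincide, so do A and B. Otherwise
    -- their join is the image of the line AB and contains the image of C, so C lies on AB.
    to-det≉0 : ∀ A B C → det (coords A) (coords B) (coords C) ≉ 0# →
      det (coords (to A)) (coords (to B)) (coords (to C)) ≉ 0#
    to-det≉0 A B C abc≉0 e
      with nonZero? (cross (coords A) (coords B)) | nonZero? (cross (coords (to A)) (coords (to B)))
    ... | inj₂ ab≈0 | _ = abc≉0 (det-cross≈0 (coords A) (coords B) (coords C) ab≈0)
    ... | inj₁ ab≉0 | inj₂ ab′≈0 = abc≉0 (det-cross≈0 (coords A) (coords B) (coords C)
      (∼⇒cross≈0 (coords A) (coords B) (to-injective A B (cross≈0⇒∼ (coords (to A)) (coords (to B))
        (coords-nonZero (to A)) (coords-nonZero (to B)) ab′≈0))))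
    ... | inj₁ ab≉0 | inj₁ ab′≉0 = abc≉0 (Equivalence.from (m⇔m′ C)
      (dot-∼ˡ {cross (coords (to A)) (coords (to B))} (coords (to C))
        (join-unique (coords m′) (coords (to A)) (coords (to B)) (coords-nonZero m′) ab′≉0
          (Equivalence.to (m⇔m′ A) (det-left (coords A) (coords B)))
          (Equivalence.to (m⇔m′ B) (det-right (coords A) (coords B)))) e))
      where
      m = point (cross (coords A) (coords B)) ab≉0
      m′ = proj₁ (preservesLines m)
      m⇔m′ = proj₂ (preservesLines m)


  E₁ E₂ E₃ E₄ : Point
  E₁ = point e₁ (0F , 1≉0)
  E₂ = point e₂ (1F , 1≉0)
  E₃ = point e₃ (2F , 1≉0)
  E₄ = point e₄ (0F , 1≉0)

  affine : Carrier → Carrier → Point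
  affine a b = point ⟨ a , b , 1# ⟩ (2F , 1≉0)

  ⟨⟩-cong : ∀ {a a′ b b′ c c′} → a ≈ a′ → b ≈ b′ → c ≈ c′ →
    ∀ i → ⟨ a , b , c ⟩ i ≈ ⟨ a′ , b′ , c′ ⟩ i
  ⟨⟩-cong e f g 0F = e
  ⟨⟩-cong e f g 1F = f
  ⟨⟩-cong e f g 2F = g

  affine-coords : ∀ v → v 2F ≉ 0# → ∃₂ λ a b → ⟨ a , b , 1# ⟩ ∼ v
  affine-coords v v₂≉0 with ≉0⇒inverse v₂≉0
  ... | w , v₂w≈1 = v 0F * w , v 1F * w , v 2F , ≉0⇒#0 v₂≉0 , λ where
      0F → scaled (v 0F)
      1F → scaled (v 1F)
      2F → *-identityʳ (v 2F)
    where
    scaled : ∀ x → v 2F * (x * w) ≈ x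
    scaled x = trans (solve 3 (λ z x w → z :* (x :* w) := z :* w :* x) refl (v 2F) x w)
      (trans (*-congʳ v₂w≈1) (*-identityˡ x))

  affine-∼⇒≈ : ∀ {a b a′ b′} → ⟨ a , b , 1# ⟩ ∼ ⟨ a′ , b′ , 1# ⟩ → a ≈ a′ × b ≈ b′
  affine-∼⇒≈ (k , _ , e) = unscale (e 0F) , unscale (e 1F)
    where
    unscale : ∀ {x y} → k * x ≈ y → x ≈ y
    unscale kx≈y = trans (sym (*-identityˡ _)) (trans (*-congʳ (sym
      (trans (sym (*-identityʳ k)) (e 2F)))) kx≈y)

  -- Coordinatisation: a collineation fixing the frame acts on the points (a,0,1) through a map σ,
  -- and the incidence constructions of sums and products make σ a field automorphism.
  module FrameFixing (χ : Collineation)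
    (fix₁ : coords (CollineationProperties.to χ E₁) ∼ e₁)
    (fix₂ : coords (CollineationProperties.to χ E₂) ∼ e₂)
    (fix₃ : coords (CollineationProperties.to χ E₃) ∼ e₃)
    (fix₄ : coords (CollineationProperties.to χ E₄) ∼ e₄) where

    open CollineationProperties χ

    -- Incidence is stated for any representative v of the image point, so that known coordinates
    -- can be inserted directly.
    record ImageLine (m : Triple) : Set (c ⊔ ℓ₁ ⊔ ℓ₂) where
      field
        image   : Triple
        nonZero : NonZero image
        to-on   : ∀ P {v} → coords (to P) ∼ v → dot m (coords P) ≈ 0# → dot image v ≈ 0#
        from-on : ∀ P {v} → coords (to P) ∼ v → dot image v ≈ 0# → dot m (coords P) ≈ 0#

    abstract
      imageLine : ∀ m → NonZero m → ImageLine m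
      imageLine m m≉0 = record
        { image = coords m′
        ; nonZero = coords-nonZero m′
        ; to-on = λ P {v} P∼v d → dot-∼ (coords m′) {coords (to P)} {v} P∼v (Equivalence.to (m⇔m′ P) d)
        ; from-on = λ P {v} P∼v d →
            Equivalence.from (m⇔m′ P) (dot-∼ (coords m′) {v} {coords (to P)} (∼-sym P∼v) d)
        }
        where
        m′ : Line
        m′ = proj₁ (Collineation.preservesLines χ (point m m≉0))
        m⇔m′ : ∀ P → P I point m m≉0 ⇔ to P I m′
        m⇔m′ = proj₂ (Collineation.preservesLines χ (point m m≉0))

    -- The line z = 0 joins the fixed points E₁ and E₂, so it is its own image.
    module AtInfinity where
      open ImageLine (imageLine e₃ (2F , 1≉0)) renaming (image to n)

      n₀≈0 : n 0F ≈ 0#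
      n₀≈0 = trans (sym (dot-e₁ n)) (to-on E₁ fix₁ (dot-e₁ e₃))

      n₁≈0 : n 1F ≈ 0#
      n₁≈0 = trans (sym (dot-e₂ n)) (to-on E₂ fix₂ (dot-e₂ e₃))

      n₂≉0 : n 2F ≉ 0#
      n₂≉0 = nonZero-⊥ n nonZero n₀≈0 n₁≈0

      dot-n : ∀ v → dot n v ≈ n 2F * v 2F
      dot-n v = +≈0⇒≈ (combination₂ (v 0F) (v 1F) n₀≈0 n₁≈0 (solve 6 (λ a b c x y z →
        :dot a b c x y z :+ c :* z := x :* a :+ y :* b) refl
        (n 0F) (n 1F) (n 2F) (v 0F) (v 1F) (v 2F)))

      infinite : ∀ P → coords P 2F ≈ 0# → coords (to P) 2F ≈ 0#
      infinite P e = *-≈0 n₂≉0 (trans (sym (dot-n (coords (to P))))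
        (to-on P {coords (to P)} ∼-refl (trans (dot-comm e₃ (coords P)) (trans (dot-e₃ (coords P)) e))))

      finite : ∀ P → coords P 2F ≉ 0# → coords (to P) 2F ≉ 0#
      finite P P₂≉0 e = P₂≉0 (trans (sym (dot-e₃ (coords P))) (trans (dot-comm (coords P) e₃)
        (from-on P {coords (to P)} ∼-refl (trans (dot-n (coords (to P))) (trans (*-congˡ e) (zeroʳ _))))))

    open AtInfinity using (infinite; finite)

    abstract
      image-coords : ∀ a b → ∃₂ λ x y → ⟨ x , y , 1# ⟩ ∼ coords (to (affine a b))
      image-coords a b = affine-coords (coords (to (affine a b))) (finite (affine a b) 1≉0)

    private

      X Y : Carrier → Carrier → Carrier
      X a b = proj₁ (image-coords a b)
      Y a b = proj₁ (proj₂ (image-coords a b))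

      to-affine-XY : ∀ a b → coords (to (affine a b)) ∼ ⟨ X a b , Y a b , 1# ⟩
      to-affine-XY a b = ∼-sym (proj₂ (proj₂ (image-coords a b)))

      -- The line x = a passes through the fixed point E₂, so its image again has constant first
      -- coordinate.
      X-cong : ∀ a b b′ → X a b ≈ X a b′
      X-cong a b b′ = +≈0⇒≈ (*-≈0 n₀≉0 (combination₃ _ _ _ d d′ nE₂ (solve 7 (λ l m n x y x′ y′ →
        l :* (x :+ x′) := :1 :* :dot l m n x y :1 :+ :1 :* :dot l m n x′ y′ :1
          :+ (y :+ y′) :* :dot l m n :0 :1 :0)
        refl (n 0F) (n 1F) (n 2F) (X a b) (Y a b) (X a b′) (Y a b′))))
        where
        open ImageLine (imageLine ⟨ 1# , 0# , a ⟩ (0F , 1≉0)) renaming (image to n)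
        on : ∀ b → dot n ⟨ X a b , Y a b , 1# ⟩ ≈ 0#
        on b = to-on (affine a b) (to-affine-XY a b)
          (solve 2 (λ a b → :dot :1 :0 a a b :1 := :0) refl a b)
        d = on b
        d′ = on b′
        nE₂ : dot n e₂ ≈ 0#
        nE₂ = to-on E₂ fix₂ (solve 1 (λ a → :dot :1 :0 a :0 :1 :0 := :0) refl a)
        n₀≉0 : n 0F ≉ 0#
        n₀≉0 n₀≈0 = nonZero-⊥ n nonZero n₀≈0 (trans (sym (dot-e₂ n)) nE₂)
          (combination₃ _ _ _ d n₀≈0 nE₂ (solve 5 (λ l m n x y →
            n := :1 :* :dot l m n x y :1 :+ x :* l :+ y :* :dot l m n :0 :1 :0)
            refl (n 0F) (n 1F) (n 2F) (X a b) (Y a b)))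

      -- Likewise the line y = b passes through the fixed point E₁.
      Y-cong : ∀ a a′ b → Y a b ≈ Y a′ b
      Y-cong a a′ b = +≈0⇒≈ (*-≈0 n₁≉0 (combination₃ _ _ _ d d′ nE₁ (solve 7 (λ l m n x y x′ y′ →
        m :* (y :+ y′) := :1 :* :dot l m n x y :1 :+ :1 :* :dot l m n x′ y′ :1
          :+ (x :+ x′) :* :dot l m n :1 :0 :0)
        refl (n 0F) (n 1F) (n 2F) (X a b) (Y a b) (X a′ b) (Y a′ b))))
        where
        open ImageLine (imageLine ⟨ 0# , 1# , b ⟩ (1F , 1≉0)) renaming (image to n)
        on : ∀ a → dot n ⟨ X a b , Y a b , 1# ⟩ ≈ 0#
        on a = to-on (affine a b) (to-affine-XY a b)
          (solve 2 (λ a b → :dot :0 :1 b a b :1 := :0) refl a b)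
        d = on a
        d′ = on a′
        nE₁ : dot n e₁ ≈ 0#
        nE₁ = to-on E₁ fix₁ (solve 1 (λ b → :dot :0 :1 b :1 :0 :0 := :0) refl b)
        n₁≉0 : n 1F ≉ 0#
        n₁≉0 n₁≈0 = nonZero-⊥ n nonZero (trans (sym (dot-e₁ n)) nE₁) n₁≈0
          (combination₃ _ _ _ d n₁≈0 nE₁ (solve 5 (λ l m n x y →
            n := :1 :* :dot l m n x y :1 :+ y :* m :+ x :* :dot l m n :1 :0 :0)
            refl (n 0F) (n 1F) (n 2F) (X a b) (Y a b)))

      module Diagonal where
        open ImageLine (imageLine ⟨ 1# , 1# , 0# ⟩ (0F , 1≉0)) public renaming (image to n)
        nE₃ : dot n e₃ ≈ 0#
        nE₃ = to-on E₃ fix₃ (solve 0 (:dot :1 :1 :0 :0 :0 :1 := :0) refl)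
        nE₄ : dot n e₄ ≈ 0#
        nE₄ = to-on E₄ fix₄ (solve 0 (:dot :1 :1 :0 :1 :1 :1 := :0) refl)
        n₀≉0 : n 0F ≉ 0#
        n₀≉0 n₀≈0 = nonZero-⊥ n nonZero n₀≈0
          (combination₃ _ _ _ n₀≈0 nE₃ nE₄ (solve 3 (λ l m n →
            m := :1 :* l :+ :1 :* :dot l m n :0 :0 :1 :+ :1 :* :dot l m n :1 :1 :1)
            refl (n 0F) (n 1F) (n 2F)))
          (trans (sym (dot-e₃ n)) nE₃)

      -- The diagonal joins the fixed points E₃ and E₄ and is mapped to itself, so one map acts on
      -- both coordinates.
      X≈Y : ∀ a → X a a ≈ Y a a
      X≈Y a = +≈0⇒≈ (*-≈0 n₀≉0 (combination₃ _ _ _ nE₃ nE₄ d (solve 5 (λ l m n x y →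
        l :* (x :+ y) := (:1 :+ y) :* :dot l m n :0 :0 :1 :+ y :* :dot l m n :1 :1 :1
          :+ :1 :* :dot l m n x y :1)
        refl (n 0F) (n 1F) (n 2F) (X a a) (Y a a))))
        where
        open Diagonal
        d : dot n ⟨ X a a , Y a a , 1# ⟩ ≈ 0#
        d = to-on (affine a a) (to-affine-XY a a) (solve 1 (λ a → :dot :1 :1 :0 a a :1 := :0) refl a)

    σ : Carrier → Carrier
    σ a = X a 0#

    to-affine : ∀ a b → coords (to (affine a b)) ∼ ⟨ σ a , σ b , 1# ⟩
    to-affine a b = ∼-trans (to-affine-XY a b) (∼-reflexive (⟨⟩-cong (X-cong a b 0#)
      (trans (Y-cong a b b) (trans (sym (X≈Y b)) (X-cong b b 0#))) refl))

    σ-cong : ∀ {a b} → a ≈ b → σ a ≈ σ b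
    σ-cong {a} {b} e = proj₁ (affine-∼⇒≈ (∼-trans (∼-sym (to-affine a 0#))
      (∼-trans (to-∼ (affine a 0#) (affine b 0#) (∼-reflexive (⟨⟩-cong e refl refl)))
        (to-affine b 0#))))

    σ-injective : ∀ {a b} → σ a ≈ σ b → a ≈ b
    σ-injective {a} {b} e = proj₁ (affine-∼⇒≈ (to-injective (affine a 0#) (affine b 0#)
      (∼-trans (to-affine a 0#) (∼-trans (∼-reflexive (⟨⟩-cong e refl refl))
        (∼-sym (to-affine b 0#))))))

    σ-0 : σ 0# ≈ 0#
    σ-0 = proj₁ (affine-∼⇒≈ (∼-trans (∼-sym (to-affine 0# 0#))
      (∼-trans (to-∼ (affine 0# 0#) E₃ ∼-refl) fix₃)))

    σ-1 : σ 1# ≈ 1#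
    σ-1 = proj₁ (affine-∼⇒≈ (∼-trans (∼-sym (to-affine 1# 1#))
      (∼-trans (to-∼ (affine 1# 1#) E₄ (∼-reflexive (⟨⟩-cong refl refl refl))) fix₄)))

    σ-≉0 : ∀ {a} → a ≉ 0# → σ a ≉ 0#
    σ-≉0 a≉0 e = a≉0 (σ-injective (trans e (sym σ-0)))

    private
      module Slope (m : Carrier) where
        open ImageLine (imageLine ⟨ m , 1# , 0# ⟩ (1F , 1≉0)) public renaming (image to n)
        nE₃ : dot n e₃ ≈ 0#
        nE₃ = to-on E₃ fix₃ (solve 1 (λ m → :dot m :1 :0 :0 :0 :1 := :0) refl m)
        d : dot n ⟨ 1# , σ m , 1# ⟩ ≈ 0#
        d = to-on (affine 1# m)
          (∼-trans (to-affine 1# m) (∼-reflexive (⟨⟩-cong σ-1 refl refl)))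
          (solve 1 (λ m → :dot m :1 :0 :1 m :1 := :0) refl m)
        n₁≉0 : n 1F ≉ 0#
        n₁≉0 n₁≈0 = nonZero-⊥ n nonZero
          (combination₃ _ _ _ d n₁≈0 nE₃ (solve 4 (λ l m n s →
            l := :1 :* :dot l m n :1 s :1 :+ s :* m :+ :1 :* :dot l m n :0 :0 :1)
            refl (n 0F) (n 1F) (n 2F) (σ m)))
          n₁≈0 (trans (sym (dot-e₃ n)) nE₃)

    -- The line y = mx joins E₃ to (1,m), so its image is y = σ(m)x, and this contains the image of
    -- (a,ma).
    σ-* : ∀ m a → σ (m * a) ≈ σ m * σ a
    σ-* m a = +≈0⇒≈ (*-≈0 n₁≉0 (combination₃ _ _ _ d d′ nE₃ (solve 6 (λ l m n s t u →
        m :* (u :+ s :* t) := t :* :dot l m n :1 s :1 :+ :1 :* :dot l m n t u :1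
          :+ (:1 :+ t) :* :dot l m n :0 :0 :1)
        refl (n 0F) (n 1F) (n 2F) (σ m) (σ a) (σ (m * a)))))
      where
      open Slope m
      d′ : dot n ⟨ σ a , σ (m * a) , 1# ⟩ ≈ 0#
      d′ = to-on (affine a (m * a)) (to-affine a (m * a))
        (solve 2 (λ m a → :dot m :1 :0 a (m :* a) :1 := :0) refl m a)

    -- The infinite point of slope m is where y = mx meets z = 0, and the images of both lines are
    -- known.
    to-slope : ∀ m → coords (to (point ⟨ 1# , m , 0# ⟩ (0F , 1≉0))) ∼ ⟨ 1# , σ m , 0# ⟩
    to-slope m = cross≈0⇒∼ A ⟨ 1# , σ m , 0# ⟩ (coords-nonZero (to P)) (0F , 1≉0) λ where
        0F → combination₁ _ A₂≈0 (solve 3 (λ x y s → x :* :0 :+ y :* s := s :* y) refl (A 1F) (A 2F) (σ m))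
        1F → combination₁ _ A₂≈0 (solve 2 (λ x y → y :* :1 :+ x :* :0 := :1 :* y) refl (A 0F) (A 2F))
        2F → *-≈0 n₁≉0 (trans (solve 7 (λ l m n x y z s →
            m :* (x :* s :+ y :* :1) := x :* :dot l m n :1 s :1 :+ :1 :* :dot l m n x y z
              :+ (x :+ z) :* :dot l m n :0 :0 :1)
            refl (n 0F) (n 1F) (n 2F) (A 0F) (A 1F) (A 2F) (σ m))
          (combination₃ _ _ _ d d′ nE₃ refl))
      where
      open Slope m
      P = point ⟨ 1# , m , 0# ⟩ (0F , 1≉0)
      A = coords (to P)
      A₂≈0 = infinite P refl
      d′ : dot n A ≈ 0#
      d′ = to-on P {A} ∼-refl (solve 1 (λ m → :dot m :1 :0 :1 m :0 := :0) refl m)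

    -- The line y = x + b joins (1,1,0) to (0,b), so its image is y = x + σ(b), and this contains
    -- the image of (a,a + b).
    σ-+ : ∀ a b → σ (a + b) ≈ σ a + σ b
    σ-+ a b = +≈0⇒≈ (*-≈0 n₁≉0 (trans (solve 6 (λ l m n s t u →
        m :* (u :+ (s :+ t)) := s :* :dot l m n :1 :1 :0 :+ :1 :* :dot l m n :0 t :1
          :+ :1 :* :dot l m n s u :1)
        refl (n 0F) (n 1F) (n 2F) (σ a) (σ b) (σ (a + b)))
        (combination₃ _ _ _ nD d₀ d refl)))
      where
      open ImageLine (imageLine ⟨ 1# , 1# , b ⟩ (0F , 1≉0)) renaming (image to n)
      nD : dot n ⟨ 1# , 1# , 0# ⟩ ≈ 0#
      nD = to-on (point ⟨ 1# , 1# , 0# ⟩ (0F , 1≉0))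
        (∼-trans (to-slope 1#) (∼-reflexive (⟨⟩-cong refl σ-1 refl)))
        (solve 1 (λ b → :dot :1 :1 b :1 :1 :0 := :0) refl b)
      d₀ : dot n ⟨ 0# , σ b , 1# ⟩ ≈ 0#
      d₀ = to-on (affine 0# b) (∼-trans (to-affine 0# b) (∼-reflexive (⟨⟩-cong σ-0 refl refl)))
        (solve 1 (λ b → :dot :1 :1 b :0 b :1 := :0) refl b)
      d : dot n ⟨ σ a , σ (a + b) , 1# ⟩ ≈ 0#
      d = to-on (affine a (a + b)) (to-affine a (a + b))
        (solve 2 (λ a b → :dot :1 :1 b a (a :+ b) :1 := :0) refl a b)
      n₁≉0 : n 1F ≉ 0#
      n₁≉0 n₁≈0 = nonZero-⊥ n nonZero
        (combination₂ _ _ nD n₁≈0 (solve 3 (λ l m n →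
          l := :1 :* :dot l m n :1 :1 :0 :+ :1 :* m) refl (n 0F) (n 1F) (n 2F)))
        n₁≈0
        (combination₂ _ _ d₀ n₁≈0 (solve 4 (λ l m n t →
          n := :1 :* :dot l m n :0 t :1 :+ t :* m) refl (n 0F) (n 1F) (n 2F) (σ b)))

    σ-surjective : ∀ c → ∃ λ a → σ a ≈ c
    σ-surjective c = let a , b , ab∼P = affine-coords (coords P) z≉0 in
      a , proj₁ (affine-∼⇒≈ (∼-trans (∼-sym (to-affine a b))
        (∼-trans (to-∼ (affine a b) P ab∼P) (to∘from (affine c 0#)))))
      where
      P = from (affine c 0#)
      z≉0 : coords P 2F ≉ 0#
      z≉0 z≈0 = ∼-≉0 2F (∼-sym (to∘from (affine c 0#))) 1≉0 (infinite P z≈0)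

    private
      scaled : ∀ {u v : Triple} k → k ≉ 0# → (∀ i → k * u i ≈ v i) → (λ i → σ (u i)) ∼ (λ i → σ (v i))
      scaled k k≉0 e = σ k , ≉0⇒#0 (σ-≉0 k≉0) , λ i → trans (sym (σ-* k _)) (σ-cong (e i))

      to-multiple : ∀ {P} (v : Triple) (v≉0 : NonZero v) {x y z k : Carrier} →
        coords (to (point v v≉0)) ∼ ⟨ x , y , z ⟩ →
        σ (v 0F) ≈ x → σ (v 1F) ≈ y → σ (v 2F) ≈ z → k ≉ 0# → (∀ i → k * v i ≈ coords P i) →
        coords (to P) ∼ (λ i → σ (coords P i))
      to-multiple {P} v v≉0 {x} {y} {z} {k} v∼ ex ey ez k≉0 e =
        ∼-trans (to-∼ P (point v v≉0) (∼-sym (k , ≉0⇒#0 k≉0 , e)))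
          (∼-trans v∼ (∼-trans (∼-sym (∼-reflexive {λ i → σ (v i)} λ where
              0F → ex
              1F → ey
              2F → ez))
            (scaled {v} {coords P} k k≉0 e)))

    -- Every point is a multiple of (a,b,1), (1,m,0) or (0,1,0), and by multiplicativity a scalar k
    -- passes through σ as σ(k).
    to≈σ : ∀ P → coords (to P) ∼ (λ i → σ (coords P i))
    to≈σ P = by-cases (coords P 2F ≟ 0#) (coords P 0F ≟ 0#)
      where
      by-cases : Dec (coords P 2F ≈ 0#) → Dec (coords P 0F ≈ 0#) →
        coords (to P) ∼ (λ i → σ (coords P i))
      by-cases (no z≉0) _ =
        let a , b , k , k#0 , e = affine-coords (coords P) z≉0 in
        to-multiple {P} ⟨ a , b , 1# ⟩ (2F , 1≉0) (to-affine a b) refl refl σ-1 (#0⇒≉0 k#0) e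
      by-cases (yes z≈0) (no x≉0) =
        let w , xw≈1 = ≉0⇒inverse x≉0
            m = coords P 1F * w
        in to-multiple {P} ⟨ 1# , m , 0# ⟩ (0F , 1≉0) (to-slope m) σ-1 refl σ-0 x≉0 λ where
             0F → *-identityʳ _
             1F → trans (solve 3 (λ x y w → x :* (y :* w) := x :* w :* y) refl
               (coords P 0F) (coords P 1F) w) (trans (*-congʳ xw≈1) (*-identityˡ _))
             2F → trans (zeroʳ _) (sym z≈0)
      by-cases (yes z≈0) (yes x≈0) =
        to-multiple {P} e₂ (1F , 1≉0) fix₂ σ-0 σ-1 σ-0
          (λ y≈0 → nonZero-⊥ (coords P) (coords-nonZero P) x≈0 y≈0 z≈0) λ where
            0F → trans (zeroʳ _) (sym x≈0)
            1F → *-identityʳ _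
            2F → trans (zeroʳ _) (sym z≈0)

  record Semilinear (φ : Collineation) : Set (c ⊔ ℓ₁ ⊔ ℓ₂) where
    open CollineationProperties φ
    field
      projectivity : Projectivity
      σ            : Carrier → Carrier
      σ-cong       : ∀ {a b} → a ≈ b → σ a ≈ σ b
      σ-injective  : ∀ {a b} → σ a ≈ σ b → a ≈ b
      σ-surjective : ∀ c → ∃ λ a → σ a ≈ c
      σ-0          : σ 0# ≈ 0#
      σ-1          : σ 1# ≈ 1#
      σ-+          : ∀ a b → σ (a + b) ≈ σ a + σ b
      σ-*          : ∀ a b → σ (a * b) ≈ σ a * σ b
      to-σ         : ∀ P → Projectivity.matrix projectivity *ᵥ (λ i → σ (coords P i)) ∼ coords (to P)

  abstract
    fundamental-theorem : ∀ φ → Semilinear φ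
    fundamental-theorem φ = record
      { projectivity = g ; σ = σ ; σ-cong = σ-cong ; σ-injective = σ-injective
      ; σ-surjective = σ-surjective ; σ-0 = σ-0 ; σ-1 = σ-1 ; σ-+ = σ-+ ; σ-* = σ-*
      ; to-σ = λ P → ∼-trans (*ᵥ-∼ matrix (∼-sym (to≈σ P))) (∼-reflexive (inverseʳ (coords (to P))))
      }
      where
      open CollineationProperties φ
      frame : ∃ λ g → let M = Projectivity.matrix g in
        M *ᵥ e₁ ∼ coords (to E₁) × M *ᵥ e₂ ∼ coords (to E₂) ×
        M *ᵥ e₃ ∼ coords (to E₃) × M *ᵥ e₄ ∼ coords (to E₄)
      frame = frame-projectivity (coords (to E₁)) (coords (to E₂)) (coords (to E₃)) (coords (to E₄))
        (to-det≉0 E₁ E₂ E₃ (λ e → 1≉0 (trans (sym det-e₁₂₃) e)))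
        (to-det≉0 E₄ E₂ E₃ (λ e → 1≉0 (trans (sym det-e₄₂₃) e)))
        (to-det≉0 E₁ E₄ E₃ (λ e → 1≉0 (trans (sym det-e₁₄₃) e)))
        (to-det≉0 E₁ E₂ E₄ (λ e → 1≉0 (trans (sym det-e₁₂₄) e)))
      g : Projectivity
      g = proj₁ frame
      open Projectivity g
      -- The projectivity g agrees with φ on the frame, so χ fixes the frame and acts as a field
      -- automorphism.
      χ : Collineation
      χ = projectivityCollineation (inverseProjectivity g) ∘ᶜ φ
      fixed : ∀ v {w} → matrix *ᵥ v ∼ w → inverse *ᵥ w ∼ v
      fixed v {w} Mv∼w = ∼-trans (*ᵥ-∼ inverse (∼-sym Mv∼w)) (∼-reflexive (inverseˡ v))
      open FrameFixing χ
        (fixed e₁ (proj₁ (proj₂ frame)))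
        (fixed e₂ (proj₁ (proj₂ (proj₂ frame))))
        (fixed e₃ (proj₁ (proj₂ (proj₂ (proj₂ frame)))))
        (fixed e₄ (proj₂ (proj₂ (proj₂ (proj₂ frame)))))

  module SemilinearProperties {φ : Collineation} (s : Semilinear φ) where
    open CollineationProperties φ
    open Semilinear s
    open Projectivity projectivity using (matrix)

    σᵥ : Triple → Triple
    σᵥ v i = σ (v i)

    σ-≉0 : ∀ {a} → a ≉ 0# → σ a ≉ 0#
    σ-≉0 a≉0 e = a≉0 (σ-injective (trans e (sym σ-0)))

    σ-^ : ∀ x n → σ (x ^′ n) ≈ σ x ^′ n
    σ-^ x zero = σ-1
    σ-^ x (suc n) = trans (σ-* x _) (*-congˡ (σ-^ x n))

    σ-dot : ∀ m v → σ (dot m v) ≈ dot (σᵥ m) (σᵥ v)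
    σ-dot m v = trans (σ-+ _ _) (+-cong (σ-* _ _) (trans (σ-+ _ _) (+-cong (σ-* _ _)
      (trans (σ-+ _ _) (+-cong (σ-* _ _) σ-0)))))

    -- `Collineation` provides images of lines. The preimage of n is σ⁻¹(nM), M being the matrix of
    -- the projectivity, because σ(m·v) = n·Mσ(v) for this m.
    preimage-line : ∀ n → NonZero n → ∃ λ m → NonZero m ×
      (∀ P → dot m (coords P) ≈ 0# ⇔ dot n (coords (to P)) ≈ 0#)
    preimage-line n n≉0 = m , m≉0 , λ P → mk⇔
      (λ d → dot-∼ n (to-σ P) (trans (sym (incidence (coords P)))
        (trans (σ-cong d) σ-0)))
      (λ d → σ-injective (trans (incidence (coords P))
        (trans (dot-∼ n (∼-sym (to-σ P)) d) (sym σ-0))))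
      where
      m : Triple
      m i = proj₁ (σ-surjective ((n ᵥ* matrix) i))
      σm≈nM : ∀ i → σᵥ m i ≈ (n ᵥ* matrix) i
      σm≈nM i = proj₂ (σ-surjective ((n ᵥ* matrix) i))
      m≉0 : NonZero m
      m≉0 = let i , nMi≉0 = ᵥ*-nonZero projectivity n≉0 in
        i , λ mi≈0 → nMi≉0 (trans (sym (σm≈nM i)) (trans (σ-cong mi≈0) σ-0))
      incidence : ∀ v → σ (dot m v) ≈ dot n (matrix *ᵥ σᵥ v)
      incidence v = trans (σ-dot m v) (trans (dot-congˡ (σᵥ v) σm≈nM)
        (sym (dot-assoc n matrix (σᵥ v))))

  -- The unital in affine coordinates and its tangents

  module AffineUnital (α β : Carrier) (β∉𝔽q : β ∉ 𝔽q) where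

    δ : Carrier
    δ = β ̄ + β

    bar-δ : δ ̄ ≈ δ
    bar-δ = trans (bar-+ _ _) (trans (+-congʳ (bar-involutive β)) (+-comm _ _))

    δ≉0 : δ ≉ 0#
    δ≉0 e = β∉𝔽q (+≈0⇒≈ e)

    β≉0 : β ≉ 0#
    β≉0 e = β∉𝔽q (trans (bar-cong e) (trans bar-0 (sym e)))

    f : Carrier → Carrier
    f x = α * (x * x) + α ̄ * (x ̄ * x ̄) + δ * (x * x ̄)

    f-cong : ∀ {x y} → x ≈ y → f x ≈ f y
    f-cong e = +-cong (+-cong (*-congˡ (*-cong e e)) (*-congˡ (*-cong (bar-cong e) (bar-cong e))))
      (*-congˡ (*-cong e (bar-cong e)))

    bar-f : ∀ x → f x ̄ ≈ f x
    bar-f x = begin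
      f x ̄                                                       ≈⟨ bar-+ _ _ ⟩
      (α * (x * x) + α ̄ * (x ̄ * x ̄)) ̄ + (δ * (x * x ̄)) ̄       ≈⟨ +-cong (bar-+ _ _) (bar-* _ _) ⟩
      (α * (x * x)) ̄ + (α ̄ * (x ̄ * x ̄)) ̄ + δ ̄ * (x * x ̄) ̄
        ≈⟨ +-cong (+-cong (trans (bar-* _ _) (*-congˡ (bar-* _ _)))
             (trans (bar-* _ _) (*-cong (bar-involutive α) (trans (bar-* _ _)
               (*-cong (bar-involutive x) (bar-involutive x))))))
             (*-cong bar-δ (norm∈𝔽q x)) ⟩
      α ̄ * (x ̄ * x ̄) + α * (x * x) + δ * (x * x ̄)               ≈⟨ +-congʳ (+-comm _ _) ⟩
      f x                                                          ∎

    f-+ : ∀ x e → f (x + e) ≈ f x + f e + δ * (x * e ̄ + x ̄ * e)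
    f-+ x e = trans
      (+-cong (+-congˡ (*-congˡ (*-cong (bar-+ x e) (bar-+ x e)))) (*-congˡ (*-congˡ (bar-+ x e))))
      (solve 7 (λ a a′ d x x′ e e′ →
        a :* ((x :+ e) :* (x :+ e)) :+ a′ :* ((x′ :+ e′) :* (x′ :+ e′)) :+ d :* ((x :+ e) :* (x′ :+ e′))
        := (a :* (x :* x) :+ a′ :* (x′ :* x′) :+ d :* (x :* x′))
        :+ (a :* (e :* e) :+ a′ :* (e′ :* e′) :+ d :* (e :* e′)) :+ d :* (x :* e′ :+ x′ :* e))
        refl α (α ̄) δ x (x ̄) e (e ̄))

    f-scale : ∀ {k} x → k ̄ ≈ k → f (k * x) ≈ k * k * f x
    f-scale {k} x k∈𝔽q = trans
      (+-cong (+-congˡ (*-congˡ (*-cong bar-kx bar-kx))) (*-congˡ (*-congˡ bar-kx)))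
      (solve 6 (λ a a′ d k x x′ →
        a :* ((k :* x) :* (k :* x)) :+ a′ :* ((k :* x′) :* (k :* x′)) :+ d :* ((k :* x) :* (k :* x′))
        := k :* k :* (a :* (x :* x) :+ a′ :* (x′ :* x′) :+ d :* (x :* x′)))
        refl α (α ̄) δ k x (x ̄))
      where
      bar-kx : (k * x) ̄ ≈ k * x ̄
      bar-kx = trans (bar-* k x) (*-congʳ k∈𝔽q)

    -- The term βxx̄ contributes (β + β̄)xx̄ = δxx̄, and r contributes r + r̄ = 0.
    trace-affine : ∀ x r → r ∈ 𝔽q → let y = α * x ^′ 2 + β * x ^′ (q ℕ.+ 1) + r in y + y ̄ ≈ f x
    trace-affine x r r∈𝔽q = trans (+-cong y≈ (trans (bar-cong y≈) (trans (bar-+ _ _)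
      (+-cong (trans (bar-+ _ _) (+-cong
        (trans (bar-* _ _) (*-congˡ (bar-* _ _)))
        (trans (bar-* _ _) (*-congˡ (norm∈𝔽q x))))) r∈𝔽q))))
      (solve 7 (λ a a′ b b′ x x′ r →
        (a :* (x :* x) :+ b :* (x :* x′) :+ r) :+ (a′ :* (x′ :* x′) :+ b′ :* (x :* x′) :+ r)
        := a :* (x :* x) :+ a′ :* (x′ :* x′) :+ (b′ :+ b) :* (x :* x′))
        refl α (α ̄) β (β ̄) x (x ̄) r)
      where
      y≈ : α * x ^′ 2 + β * x ^′ (q ℕ.+ 1) + r ≈ α * (x * x) + β * (x * x ̄) + r
      y≈ = +-congʳ (+-cong (*-congˡ (x^2≈xx x)) (*-congˡ (trans (^[q+1] x) (*-comm _ _))))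

    -- The parameter r has to be y + y₀, where y₀ belongs to r = 0. It lies in 𝔽q because y and y₀
    -- have the same trace f(x).
    affine∈𝒰 : ∀ {P x y} → coords P ∼ ⟨ x , y , 1# ⟩ → y + y ̄ ≈ f x → P ∈ 𝒰 α β
    affine∈𝒰 {P} {x} {y} P∼ e = inj₁ (x , y + y₀ , r∈𝔽q ,
      ∼-trans P∼ (∼-reflexive (⟨⟩-cong refl
        (solve 2 (λ y z → y := z :+ (y :+ z)) refl y y₀) refl)))
      where
      y₀ = α * x ^′ 2 + β * x ^′ (q ℕ.+ 1)
      T-y₀ : y₀ + y₀ ̄ ≈ f x
      T-y₀ = trans (+-cong (sym (+-identityʳ y₀)) (bar-cong (sym (+-identityʳ y₀))))
        (trace-affine x 0# bar-0)
      r∈𝔽q : (y + y₀) ̄ ≈ y + y₀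
      r∈𝔽q = trans (bar-+ _ _) (+≈0⇒≈ (trans
        (solve 4 (λ y y′ z z′ → (y′ :+ z′) :+ (y :+ z) := (y :+ y′) :+ (z :+ z′))
          refl y (y ̄) y₀ (y₀ ̄))
        (≈⇒+≈0 (trans e (sym T-y₀)))))

    𝒰⇒affine : ∀ {P} → P ∈ 𝒰 α β →
      (∃₂ λ x y → coords P ∼ ⟨ x , y , 1# ⟩ × y + y ̄ ≈ f x) ⊎ coords P ∼ e₂
    𝒰⇒affine (inj₁ (x , r , r∈𝔽q , P∼)) = inj₁ (x , _ , P∼ , trace-affine x r r∈𝔽q)
    𝒰⇒affine (inj₂ P∼) = inj₂ P∼

    module NonClassical (α≉0 : α ≉ 0#) {t}
      (tδ²≈N : t * δ ^′ 2 ≈ α ^′ (q ℕ.+ 1)) (Tr-t : Tr t ≈ 0#) where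

      -- A nontrivial zero x of f makes s = ᾱ x̄ / (δ x) a root of s² + s = t with s s̄ = t, so
      -- that s̄ = s + 1 and Tr t = s̄ + s = 1.
      anisotropic : ∀ {x} → x ≉ 0# → f x ≉ 0#
      anisotropic {x} x≉0 fx≈0 = 1≉0 (trans (sym s̄+s≈1) (trans (sym (Tr-artin-schreier s²+s≈t)) Tr-t))
        where
        X D s : Carrier
        X = proj₁ (≉0⇒inverse x≉0)
        D = proj₁ (≉0⇒inverse δ≉0)
        s = α ̄ * (x ̄ * (X * D))
        xX≈1 : x * X ≈ 1#
        xX≈1 = proj₂ (≉0⇒inverse x≉0)
        δD≈1 : δ * D ≈ 1#
        δD≈1 = proj₂ (≉0⇒inverse δ≉0)
        bar-inverse : ∀ {a b} → a * b ≈ 1# → a ̄ * b ̄ ≈ 1#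
        bar-inverse e = trans (sym (bar-* _ _)) (trans (bar-cong e) bar-1)
        N≈ : t * (δ * δ) ≈ α ̄ * α
        N≈ = trans (*-congˡ (sym (x^2≈xx δ))) (trans tδ²≈N (^[q+1] α))
        t≈ : t ≈ α ̄ * α * (D * D)
        t≈ = begin
          t                          ≈⟨ solve 1 (λ t → t := t :* (:1 :* :1)) refl t ⟩
          t * (1# * 1#)              ≈⟨ *-congˡ (*-cong δD≈1 δD≈1) ⟨
          t * ((δ * D) * (δ * D))    ≈⟨ solve 3 (λ t d e →
            t :* ((d :* e) :* (d :* e)) := t :* (d :* d) :* (e :* e)) refl t δ D ⟩
          t * (δ * δ) * (D * D)      ≈⟨ *-congʳ N≈ ⟩
          α ̄ * α * (D * D)          ∎
        s²+s≈t : s * s + s ≈ t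
        -- Inserting factors xX = 1 and δD = 1 homogenises s² + s + t to ᾱ(XD)² f(x).
        s²+s≈t = trans (+≈0⇒≈ (begin
          s * s + s + α ̄ * α * (D * D)   ≈⟨ solve 5 (λ a a′ x′ X D →
            let s = a′ :* (x′ :* (X :* D)) in
            s :* s :+ s :+ a′ :* a :* (D :* D) :=
            s :* s :+ :1 :* :1 :* s :+ a′ :* a :* (D :* D) :* (:1 :* :1))
            refl α (α ̄) (x ̄) X D ⟩
          s * s + 1# * 1# * s + α ̄ * α * (D * D) * (1# * 1#)
            ≈⟨ +-cong (+-congˡ (*-congʳ (*-cong xX≈1 δD≈1))) (*-congˡ (*-cong xX≈1 xX≈1)) ⟨
          s * s + (x * X) * (δ * D) * s + α ̄ * α * (D * D) * ((x * X) * (x * X))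
            ≈⟨ solve 7 (λ a a′ d x x′ X D →
            let s = a′ :* (x′ :* (X :* D)) in
            s :* s :+ (x :* X) :* (d :* D) :* s :+ a′ :* a :* (D :* D) :* ((x :* X) :* (x :* X)) :=
            a′ :* (X :* D) :* (X :* D) :* (a :* (x :* x) :+ a′ :* (x′ :* x′) :+ d :* (x :* x′)))
            refl α (α ̄) δ x (x ̄) X D ⟩
          α ̄ * (X * D) * (X * D) * f x   ≈⟨ trans (*-congˡ fx≈0) (zeroʳ _) ⟩
          0#                               ∎)) (sym t≈)
        bar-D : D ̄ ≈ D
        bar-D = *-cancelˡ δ≉0 (trans (*-congʳ (sym bar-δ)) (trans (bar-inverse δD≈1) (sym δD≈1)))
        bar-s : s ̄ ≈ α * (x * (X ̄ * D))
        bar-s = trans (bar-* _ _) (*-cong (bar-involutive α) (trans (bar-* _ _)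
          (*-cong (bar-involutive x) (trans (bar-* _ _) (*-congˡ bar-D)))))
        ss̄≈t : s * s ̄ ≈ t
        ss̄≈t = begin
          s * s ̄                                    ≈⟨ *-congˡ bar-s ⟩
          s * (α * (x * (X ̄ * D)))                  ≈⟨ solve 7 (λ a a′ x x′ X X′ D →
            a′ :* (x′ :* (X :* D)) :* (a :* (x :* (X′ :* D))) :=
            a′ :* a :* (D :* D) :* ((x :* X) :* (x′ :* X′))) refl α (α ̄) x (x ̄) X (X ̄) D ⟩
          α ̄ * α * (D * D) * ((x * X) * (x ̄ * X ̄)) ≈⟨ *-congˡ (*-cong xX≈1 (bar-inverse xX≈1)) ⟩
          α ̄ * α * (D * D) * (1# * 1#)              ≈⟨ solve 1 (λ t → t :* (:1 :* :1) := t) refl _ ⟩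
          α ̄ * α * (D * D)                          ≈⟨ t≈ ⟨
          t                                           ∎
        inverse≉0 : ∀ {a b} → a * b ≈ 1# → b ≉ 0#
        inverse≉0 e b≈0 = 1≉0 (trans (sym e) (trans (*-congˡ b≈0) (zeroʳ _)))
        s≉0 : s ≉ 0#
        s≉0 = *-≉0 (bar-≉0 α≉0) (*-≉0 (bar-≉0 x≉0) (*-≉0 (inverse≉0 xX≈1) (inverse≉0 δD≈1)))
        s̄+s≈1 : s ̄ + s ≈ 1#
        s̄+s≈1 = +≈0⇒≈ (*-≈0 s≉0 (trans
          (solve 2 (λ s s′ → s :* (s′ :+ s :+ :1) := (s :* s :+ s) :+ s :* s′) refl s (s ̄))
          (≈⇒+≈0 (trans s²+s≈t (sym ss̄≈t)))))

      -- If s ≠ δ x̄₀, put n = s + δ x̄₀. The line also meets the unital over x₀ + e, where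
      -- e = k β/n and k ∈ 𝔽q is chosen so that f e = n e + n̄ ē.
      tangent-slope : ∀ x₀ y₀ s → y₀ + y₀ ̄ ≈ f x₀ →
        (∀ e → (y₀ + s * e) + (y₀ + s * e) ̄ ≈ f (x₀ + e) → e ≈ 0#) → s ≈ δ * x₀ ̄
      tangent-slope x₀ y₀ s on only = decidable-stable (s ≟ δ * x₀ ̄) secant
        where
        secant : ¬ ¬ (s ≈ δ * x₀ ̄)
        secant s≉ = e≉0 (only e (+≈0⇒≈ (begin
          (y₀ + s * e) + (y₀ + s * e) ̄ + f (x₀ + e)
            ≈⟨ +-cong (+-congˡ (trans (bar-+ _ _) (+-congˡ (bar-* _ _)))) (f-+ x₀ e) ⟩
          (y₀ + s * e) + (y₀ ̄ + s ̄ * e ̄) + (f x₀ + f e + δ * (x₀ * e ̄ + x₀ ̄ * e))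
            ≈⟨ solve 11 (λ y y′ s s′ e e′ g g′ d x x′ →
              (y :+ s :* e) :+ (y′ :+ s′ :* e′) :+ (g :+ g′ :+ d :* (x :* e′ :+ x′ :* e)) :=
              (y :+ y′ :+ g) :+ (g′ :+ ((s :+ d :* x′) :* e :+ (s′ :+ d :* x) :* e′)))
              refl y₀ (y₀ ̄) s (s ̄) e (e ̄) (f x₀) (f e) δ x₀ (x₀ ̄) ⟩
          (y₀ + y₀ ̄ + f x₀) + (f e + (n * e + (s ̄ + δ * x₀) * e ̄))
            ≈⟨ +-cong (≈⇒+≈0 on) (≈⇒+≈0 (trans fe≈kδ (sym (trans (+-cong ne≈ n̄ē≈) (trans
                 (sym (distribˡ k β (β ̄))) (*-congˡ (+-comm _ _))))))) ⟩
          0# + 0# ≈⟨ +-identityʳ 0# ⟩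
          0# ∎)))
          where
          n N e₀ F k e : Carrier
          n = s + δ * x₀ ̄
          n≉0 : n ≉ 0#
          n≉0 n≈0 = s≉ (+≈0⇒≈ n≈0)
          N = proj₁ (≉0⇒inverse n≉0)
          nN≈1 : n * N ≈ 1#
          nN≈1 = proj₂ (≉0⇒inverse n≉0)
          e₀ = β * N
          e₀≉0 : e₀ ≉ 0#
          e₀≉0 = *-≉0 β≉0 (λ N≈0 → 1≉0 (trans (sym nN≈1) (trans (*-congˡ N≈0) (zeroʳ n))))
          fe₀≉0 : f e₀ ≉ 0#
          fe₀≉0 = anisotropic e₀≉0
          F = proj₁ (≉0⇒inverse fe₀≉0)
          fe₀F≈1 : f e₀ * F ≈ 1#
          fe₀F≈1 = proj₂ (≉0⇒inverse fe₀≉0)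
          -- Since n e₀ = β, the linear terms add up to k(β + β̄) = kδ, while f(e) = k² f(e₀).
          -- Equality with k ≠ 0 forces k = δ / f(e₀); anisotropy allows the division.
          k = δ * F
          bar-F : F ̄ ≈ F
          bar-F = *-cancelˡ fe₀≉0 (trans (*-congʳ (sym (bar-f e₀))) (trans (sym (bar-* _ _))
            (trans (bar-cong fe₀F≈1) (trans bar-1 (sym fe₀F≈1)))))
          bar-k : k ̄ ≈ k
          bar-k = trans (bar-* _ _) (*-cong bar-δ bar-F)
          e = k * e₀
          e≉0 : e ≉ 0#
          e≉0 = *-≉0 (*-≉0 δ≉0 (λ F≈0 → 1≉0 (trans (sym fe₀F≈1) (trans (*-congˡ F≈0) (zeroʳ _))))) e₀≉0
          ne≈ : n * e ≈ k * β
          ne≈ = trans (solve 4 (λ n k b N → n :* (k :* (b :* N)) := k :* b :* (n :* N)) refl n k β N)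
            (trans (*-congˡ nN≈1) (*-identityʳ _))
          n̄ē≈ : (s ̄ + δ * x₀) * e ̄ ≈ k * β ̄
          n̄ē≈ = trans (*-congʳ (sym (trans (bar-+ _ _) (+-congˡ (trans (bar-* _ _)
            (*-cong bar-δ (bar-involutive x₀))))))) (trans (sym (bar-* n e)) (trans (bar-cong ne≈)
              (trans (bar-* k β) (*-congʳ bar-k))))
          fe≈kδ : f e ≈ k * δ
          fe≈kδ = trans (f-scale e₀ bar-k) (trans
            (solve 4 (λ k d F g → k :* (d :* F) :* g := k :* d :* (g :* F)) refl k δ F (f e₀))
            (trans (*-congˡ fe₀F≈1) (*-identityʳ _)))

      -- The feet of an affine point

      foot : Carrier → Carrier → Carrier → Triple
      foot a b e = ⟨ a + e , b + δ * a ̄ * e + δ * (e * e ̄) , 1# ⟩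

      foot-cong : ∀ a b {e e′} → e ≈ e′ → ∀ i → foot a b e i ≈ foot a b e′ i
      foot-cong a b e≈e′ = ⟨⟩-cong (+-congˡ e≈e′)
        (+-cong (+-congˡ (*-congˡ e≈e′)) (*-congˡ (*-cong e≈e′ (bar-cong e≈e′)))) refl

      κ : Carrier → Carrier → Carrier
      κ a b = b + b ̄ + f a

      Touches : Triple → Point → Set (c ⊔ ℓ₁ ⊔ ℓ₂)
      Touches m Q = ∀ R → R ∈ 𝒰 α β → dot m (coords R) ≈ 0# → coords R ∼ coords Q

      -- The affine points of the line are (x₀ + e, y₀ + se) with s = m₀/m₁, so tangency turns into
      -- the hypothesis of `tangent-slope`.
      touching-slope : ∀ m {Q x₀ y₀} → m 1F ≉ 0# → Touches m Q → dot m (coords Q) ≈ 0# →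
        coords Q ∼ ⟨ x₀ , y₀ , 1# ⟩ → y₀ + y₀ ̄ ≈ f x₀ → m 0F ≈ m 1F * (δ * x₀ ̄)
      touching-slope m {Q} {x₀} {y₀} m₁≉0 touches mQ Q∼ on = trans (sym m₁s≈m₀)
        (*-congˡ (tangent-slope x₀ y₀ s on only))
        where
        M s : Carrier
        M = proj₁ (≉0⇒inverse m₁≉0)
        s = m 0F * M
        m₁s≈m₀ : m 1F * s ≈ m 0F
        m₁s≈m₀ = trans (solve 3 (λ l m M → m :* (l :* M) := l :* (m :* M)) refl (m 0F) (m 1F) M)
          (trans (*-congˡ (proj₂ (≉0⇒inverse m₁≉0))) (*-identityʳ _))
        only : ∀ e → (y₀ + s * e) + (y₀ + s * e) ̄ ≈ f (x₀ + e) → e ≈ 0#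
        only e e-on = trans (+≈0⇒≈ (trans (solve 2 (λ e x → e :+ :0 := (x :+ e) :+ x) refl e x₀)
          (≈⇒+≈0 (proj₁ (affine-∼⇒≈ (∼-trans
            (touches R (affine∈𝒰 {R} ∼-refl e-on) mR) Q∼)))))) refl
          where
          R = affine (x₀ + e) (y₀ + s * e)
          mR : dot m (coords R) ≈ 0#
          mR = combination₂ _ _ (dot-∼ m Q∼ mQ) (≈⇒+≈0 m₁s≈m₀) (solve 7 (λ l m n x y e s →
            :dot l m n (x :+ e) (y :+ s :* e) :1 := :1 :* :dot l m n x y :1 :+ e :* (m :* s :+ l))
            refl (m 0F) (m 1F) (m 2F) x₀ y₀ e s)

      E₂∈𝒰 : E₂ ∈ 𝒰 α β
      E₂∈𝒰 = inj₂ ∼-refl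

      ∼e₂⇒≈0 : ∀ {v} → v ∼ e₂ → v 2F ≈ 0#
      ∼e₂⇒≈0 {v} (k , k#0 , e) = *-≈0 (#0⇒≉0 k#0) (e 2F)

      -- The line joining (0,1,0) to (a,b) also contains the affine point of the unital over a with
      -- r = 0.
      touching-at-infinity : ∀ m {Q} a b → coords Q ∼ e₂ → Touches m Q → dot m (coords Q) ≈ 0# →
        dot m ⟨ a , b , 1# ⟩ ≈ 0# → ⊥
      touching-at-infinity m {Q} a b Q∼e₂ touches mQ mP =
        1≉0 (∼e₂⇒≈0 (∼-trans (touches R R∈𝒰 mR) Q∼e₂))
        where
        y = α * a ^′ 2 + β * a ^′ (q ℕ.+ 1)
        R = affine a y
        R∈𝒰 : R ∈ 𝒰 α β
        R∈𝒰 = inj₁ (a , 0# , bar-0 , ∼-reflexive (⟨⟩-cong refl (sym (+-identityʳ y)) refl))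
        mR : dot m (coords R) ≈ 0#
        mR = combination₂ _ _ mP (dot-∼ m Q∼e₂ mQ) (solve 6 (λ l m n x y z →
          :dot l m n x y :1 := :1 :* :dot l m n x z :1 :+ (y :+ z) :* :dot l m n :0 :1 :0)
          refl (m 0F) (m 1F) (m 2F) a y b)

      -- The tangent at (x₀,y₀) passes through (a,b), so y₀ = b + δx̄₀e with e = x₀ + a. Writing x̄₀
      -- = ā + ē gives the coordinates of the foot; inserting f(x₀) = y₀ + ȳ₀ into the expansion of
      -- f(x₀ + a) gives the condition on f(e).
      foot-of-touching-line : ∀ m {Q} a b → NonZero m → Q ∈ 𝒰 α β → Touches m Q →
        dot m (coords Q) ≈ 0# → dot m ⟨ a , b , 1# ⟩ ≈ 0# →
        ∃ λ e → coords Q ∼ foot a b e × f e ≈ κ a b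
      foot-of-touching-line m {Q} a b m≉0 Q∈𝒰 touches mQ mP = by-cases (𝒰⇒affine {Q} Q∈𝒰)
        where
        by-cases : (∃₂ λ x y → coords Q ∼ ⟨ x , y , 1# ⟩ × y + y ̄ ≈ f x) ⊎ coords Q ∼ e₂ →
          ∃ λ e → coords Q ∼ foot a b e × f e ≈ κ a b
        by-cases (inj₂ Q∼e₂) = ⊥-elim (touching-at-infinity m {Q} a b Q∼e₂ touches mQ mP)
        by-cases (inj₁ (x₀ , y₀ , Q∼ , on)) = e ,
          ∼-trans Q∼ (∼-reflexive (⟨⟩-cong
            (solve 2 (λ a x → x := a :+ (x :+ a)) refl a x₀) y₀≈ refl)) , fe≈κ
          where
          e : Carrier
          e = x₀ + a
          -- A line with m₁ = 0 contains (0,1,0), a second point of the unital.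
          m₁≉0 : m 1F ≉ 0#
          m₁≉0 m₁≈0 = 1≉0 (∼e₂⇒≈0 (∼-sym (∼-trans
            (touches E₂ E₂∈𝒰 (trans (dot-e₂ m) m₁≈0)) Q∼)))
          m₀≈ : m 0F ≈ m 1F * (δ * x₀ ̄)
          m₀≈ = touching-slope m {Q} m₁≉0 touches mQ Q∼ on
          b≈ : y₀ ≈ b + δ * x₀ ̄ * e
          b≈ = +≈0⇒≈ (*-≈0 m₁≉0 (combination₃ _ _ _ mP (dot-∼ m Q∼ mQ) (≈⇒+≈0 m₀≈)
            (solve 9 (λ l m n a b x y d x′ →
              m :* (y :+ (b :+ d :* x′ :* (x :+ a))) := :1 :* :dot l m n a b :1
                :+ :1 :* :dot l m n x y :1 :+ (x :+ a) :* (l :+ m :* (d :* x′)))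
              refl (m 0F) (m 1F) (m 2F) a b x₀ y₀ δ (x₀ ̄))))
          y₀≈ : y₀ ≈ b + δ * a ̄ * e + δ * (e * e ̄)
          y₀≈ = trans b≈ (trans (solve 6 (λ b d x a x′ a′ →
            b :+ d :* x′ :* (x :+ a) := b :+ d :* a′ :* (x :+ a) :+ d :* ((x :+ a) :* (x′ :+ a′)))
            refl b δ x₀ a (x₀ ̄) (a ̄)) (+-congˡ (*-congˡ (*-congˡ (sym (bar-+ x₀ a))))))
          bar-y₀ : y₀ ̄ ≈ b ̄ + δ * x₀ * (x₀ ̄ + a ̄)
          bar-y₀ = trans (bar-cong b≈) (trans (bar-+ _ _) (+-congˡ (trans (bar-* _ _)
            (*-cong (trans (bar-* _ _) (*-cong bar-δ (bar-involutive x₀))) (bar-+ x₀ a)))))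
          fe≈κ : f e ≈ κ a b
          fe≈κ = begin
            f (x₀ + a)                                            ≈⟨ f-+ x₀ a ⟩
            f x₀ + f a + δ * (x₀ * a ̄ + x₀ ̄ * a)
              ≈⟨ +-congʳ (+-congʳ (trans (sym on) (+-cong b≈ bar-y₀))) ⟩
            (b + δ * x₀ ̄ * e) + (b ̄ + δ * x₀ * (x₀ ̄ + a ̄)) + f a + δ * (x₀ * a ̄ + x₀ ̄ * a)
              ≈⟨ solve 8 (λ b b′ d x x′ a a′ g →
                (b :+ d :* x′ :* (x :+ a)) :+ (b′ :+ d :* x :* (x′ :+ a′)) :+ g
                  :+ d :* (x :* a′ :+ x′ :* a) := b :+ b′ :+ g)
                refl b (b ̄) δ x₀ (x₀ ̄) a (a ̄) (f a) ⟩
            κ a b                                                 ∎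

      pedal⇒foot : ∀ {P Q} a b → coords P ∼ ⟨ a , b , 1# ⟩ → Q ∈ pedal (𝒰 α β) P →
        ∃ λ e → coords Q ∼ foot a b e × f e ≈ κ a b
      pedal⇒foot {P} {Q} a b P∼ (Q∈𝒰 , m , (Q′ , Q′∈𝒰 , Q′Im , unique) , PIm , QIm) =
        foot-of-touching-line (coords m) {Q} a b (coords-nonZero m) Q∈𝒰
          -- Q lies on the unital and on the tangent, so it is the point of contact Q′.
          (λ R R∈𝒰 RIm → ∼-trans (unique R R∈𝒰 RIm) (∼-sym (unique Q Q∈𝒰 QIm)))
          QIm (dot-∼ (coords m) P∼ PIm)

      -- Lines meeting the set of feet

      square-injective : ∀ {x y} → x * x ≈ y * y → x ≈ y
      square-injective {x} {y} e = decidable-stable (x ≟ y) λ x≉y →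
        *-≉0 (λ z → x≉y (+≈0⇒≈ z)) (λ z → x≉y (+≈0⇒≈ z)) (trans
          (solve 2 (λ x y → (x :+ y) :* (x :+ y) := x :* x :+ y :* y) refl x y) (≈⇒+≈0 e))

      -- The element αe² and its conjugate have sum k + δl and product αᾱl², which leaves two values
      -- for αe². It determines e because α ≠ 0 and squaring is injective in characteristic 2.
      norm-circle : ∀ {k l e₁ e₂ e₃} → f e₁ ≈ k → f e₂ ≈ k → f e₃ ≈ k →
        e₁ * e₁ ̄ ≈ l → e₂ * e₂ ̄ ≈ l → e₃ * e₃ ̄ ≈ l → e₁ ≈ e₂ ⊎ e₁ ≈ e₃ ⊎ e₂ ≈ e₃
      norm-circle {k} {l} f₁ f₂ f₃ n₁ n₂ n₃ = ⊎-map cancel (⊎-map cancel cancel)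
        (quadratic-roots (root f₁ n₁) (root f₂ n₂) (root f₃ n₃))
        where
        cancel : ∀ {x y} → α * (x * x) ≈ α * (y * y) → x ≈ y
        cancel e = square-injective (*-cancelˡ α≉0 e)
        root : ∀ {e} → f e ≈ k → e * e ̄ ≈ l →
          α * (e * e) * (α * (e * e)) + (k + δ * l) * (α * (e * e)) ≈ α * α ̄ * (l * l)
        root {e} fe≈k n≈l = begin
          α * (e * e) * (α * (e * e)) + (k + δ * l) * (α * (e * e))
            ≈⟨ +-congˡ (*-congʳ (+-cong fe≈k (*-congˡ n≈l))) ⟨
          α * (e * e) * (α * (e * e)) + (f e + δ * (e * e ̄)) * (α * (e * e))
            ≈⟨ solve 5 (λ a a′ d e e′ →
              a :* (e :* e) :* (a :* (e :* e)) :+ (a :* (e :* e) :+ a′ :* (e′ :* e′) :+ d :* (e :* e′)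
                :+ d :* (e :* e′)) :* (a :* (e :* e)) := a :* a′ :* ((e :* e′) :* (e :* e′)))
              refl α (α ̄) δ e (e ̄) ⟩
          α * α ̄ * ((e * e ̄) * (e * e ̄)) ≈⟨ *-congˡ (*-cong n≈l n≈l) ⟩
          α * α ̄ * (l * l) ∎

      -- Put N = eē, an element of 𝔽q. The equation and its conjugate read se = N + l and s̄ē = N +
      -- l̄, and their product is ss̄N = (N + l)(N + l̄).
      norm-line : ∀ {s l e₁ e₂ e₃} → s ≉ 0# →
        e₁ * e₁ ̄ + s * e₁ ≈ l → e₂ * e₂ ̄ + s * e₂ ≈ l → e₃ * e₃ ̄ + s * e₃ ≈ l →
        e₁ ≈ e₂ ⊎ e₁ ≈ e₃ ⊎ e₂ ≈ e₃
      norm-line {s} {l} s≉0 l₁ l₂ l₃ = ⊎-map (cancel l₁ l₂) (⊎-map (cancel l₁ l₃) (cancel l₂ l₃))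
        (quadratic-roots (root l₁) (root l₂) (root l₃))
        where
        cancel : ∀ {x y} → x * x ̄ + s * x ≈ l → y * y ̄ + s * y ≈ l → x * x ̄ ≈ y * y ̄ → x ≈ y
        cancel {x} {y} lx ly n = *-cancelˡ s≉0 (+≈0⇒≈ (trans
          (solve 4 (λ u v m n → u :+ v := (m :+ u) :+ (n :+ v) :+ (m :+ n)) refl
            (s * x) (s * y) (x * x ̄) (y * y ̄))
          (trans (+-cong (≈⇒+≈0 (trans lx (sym ly))) (≈⇒+≈0 n)) (+-identityʳ 0#))))
        root : ∀ {e} → e * e ̄ + s * e ≈ l →
          e * e ̄ * (e * e ̄) + (l + l ̄ + s * s ̄) * (e * e ̄) ≈ l * l ̄
        root {e} le = +≈0⇒≈ (begin
          e * e ̄ * (e * e ̄) + (l + l ̄ + s * s ̄) * (e * e ̄) + l * l ̄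
            ≈⟨ solve 6 (λ e e′ l l′ s s′ →
              e :* e′ :* (e :* e′) :+ (l :+ l′ :+ s :* s′) :* (e :* e′) :+ l :* l′ :=
              (e :* e′ :+ l) :* ((e :* e′ :+ s′ :* e′) :+ l′) :+
              (s′ :* e′) :* ((e :* e′ :+ s :* e) :+ l)) refl e (e ̄) l (l ̄) s (s ̄) ⟩
          (e * e ̄ + l) * ((e * e ̄ + s ̄ * e ̄) + l ̄) + (s ̄ * e ̄) * ((e * e ̄ + s * e) + l)
            ≈⟨ combination₂ _ _ (≈⇒+≈0 bar-le) (≈⇒+≈0 le) refl ⟩
          0# ∎)
          where
          bar-le : e * e ̄ + s ̄ * e ̄ ≈ l ̄
          bar-le = trans (sym (trans (bar-+ _ _) (+-cong (norm∈𝔽q e) (bar-* s e)))) (bar-cong le)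

      -- A line [m₀,m₁,m₂] with m₁ ≠ 0 meets the feet where e ē + s e = l.  If s = 0, then α e² is a
      -- root of Z² + (κ + δ l) Z + αᾱ l²; if s ≠ 0, then the norm e ē, which determines e, is a root
      -- of Z² + (l + l̄ + s s̄) Z + l l̄.
      collinear-feet : ∀ a b m {e₁ e₂ e₃} → NonZero m →
        f e₁ ≈ κ a b → f e₂ ≈ κ a b → f e₃ ≈ κ a b →
        dot m (foot a b e₁) ≈ 0# → dot m (foot a b e₂) ≈ 0# → dot m (foot a b e₃) ≈ 0# →
        e₁ ≈ e₂ ⊎ e₁ ≈ e₃ ⊎ e₂ ≈ e₃
      collinear-feet a b m {e₁} {e₂} {e₃} m≉0 f₁ f₂ f₃ m₁ m₂ m₃ = by-cases (m 1F ≟ 0#)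
        where
        by-cases : Dec (m 1F ≈ 0#) → e₁ ≈ e₂ ⊎ e₁ ≈ e₃ ⊎ e₂ ≈ e₃
        -- With m₁ = 0 the line fixes the first coordinate a + e.
        by-cases (yes m₁≈0) = inj₁ (+≈0⇒≈ (*-≈0 m₀≉0 (combination₃ _ _ _ m₁ m₂ m₁≈0
          (solve 8 (λ l m n a e e′ y y′ → l :* (e :+ e′) := :1 :* :dot l m n (a :+ e) y :1
            :+ :1 :* :dot l m n (a :+ e′) y′ :1 :+ (y :+ y′) :* m)
            refl (m 0F) (m 1F) (m 2F) a e₁ e₂ (foot a b e₁ 1F) (foot a b e₂ 1F)))))
          where
          m₀≉0 : m 0F ≉ 0#
          m₀≉0 m₀≈0 = nonZero-⊥ m m≉0 m₀≈0 m₁≈0 (combination₃ _ _ _ m₁ m₀≈0 m₁≈0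
            (solve 5 (λ l m n x y → n := :1 :* :dot l m n x y :1 :+ x :* l :+ y :* m)
              refl (m 0F) (m 1F) (m 2F) (foot a b e₁ 0F) (foot a b e₁ 1F)))
        by-cases (no m₁≉0) = on-norm (s ≟ 0#)
          where
          u U s l : Carrier
          u = m 1F * δ
          u≉0 : u ≉ 0#
          u≉0 = *-≉0 m₁≉0 δ≉0
          U = proj₁ (≉0⇒inverse u≉0)
          uU≈1 : u * U ≈ 1#
          uU≈1 = proj₂ (≉0⇒inverse u≉0)
          -- Substituting the foot into the line and dividing by m₁δ, the coefficient of eē, leaves
          -- eē + se = l.
          s = U * (m 0F + m 1F * (δ * a ̄))
          l = U * (m 0F * a + m 1F * b + m 2F)
          equation : ∀ e → dot m (foot a b e) ≈ 0# → e * e ̄ + s * e ≈ l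
          equation e d = +≈0⇒≈ (combination₂ _ _ d (≈⇒+≈0 uU≈1) (solve 10 (λ m₀ m₁ m₂ U a b d a′ e e′ →
            e :* e′ :+ U :* (m₀ :+ m₁ :* (d :* a′)) :* e :+ U :* (m₀ :* a :+ m₁ :* b :+ m₂) :=
            U :* :dot m₀ m₁ m₂ (a :+ e) (b :+ d :* a′ :* e :+ d :* (e :* e′)) :1
              :+ e :* e′ :* (m₁ :* d :* U :+ :1))
            refl (m 0F) (m 1F) (m 2F) U a b δ (a ̄) e (e ̄)))
          on-norm : Dec (s ≈ 0#) → e₁ ≈ e₂ ⊎ e₁ ≈ e₃ ⊎ e₂ ≈ e₃
          on-norm (no s≉0) = norm-line s≉0 (equation e₁ m₁) (equation e₂ m₂) (equation e₃ m₃)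
          on-norm (yes s≈0) = norm-circle f₁ f₂ f₃ (circle e₁ m₁) (circle e₂ m₂) (circle e₃ m₃)
            where
            circle : ∀ e → dot m (foot a b e) ≈ 0# → e * e ̄ ≈ l
            circle e d = trans (sym (trans (+-congˡ (trans (*-congʳ s≈0) (zeroˡ e))) (+-identityʳ _)))
              (equation e d)

    -- The classical case α = 0

    module Classical (α≈0 : α ≈ 0#) where

      -- The Hermitian form obtained by homogenising y + ȳ = δxx̄.
      form : Triple → Carrier
      form v = v 1F * v 2F ̄ + v 1F ̄ * v 2F + δ * (v 0F * v 0F ̄)

      form-cong : ∀ {u v : Triple} → (∀ i → u i ≈ v i) → form u ≈ form v
      form-cong e = +-cong (+-cong (*-cong (e 1F) (bar-cong (e 2F))) (*-cong (bar-cong (e 1F)) (e 2F)))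
        (*-congˡ (*-cong (e 0F) (bar-cong (e 0F))))

      form-scale : ∀ k v → form (λ i → k * v i) ≈ k * k ̄ * form v
      form-scale k v = trans
        (+-cong (+-cong (*-congˡ (bar-* _ _)) (*-congʳ (bar-* _ _))) (*-congˡ (*-congˡ (bar-* _ _))))
        (solve 9 (λ k k′ d x x′ y y′ z z′ →
          (k :* y) :* (k′ :* z′) :+ (k′ :* y′) :* (k :* z) :+ d :* ((k :* x) :* (k′ :* x′)) :=
          k :* k′ :* (y :* z′ :+ y′ :* z :+ d :* (x :* x′)))
          refl k (k ̄) δ (v 0F) (v 0F ̄) (v 1F) (v 1F ̄) (v 2F) (v 2F ̄))

      form-∼ : ∀ {u v} → u ∼ v → form u ≈ 0# → form v ≈ 0#
      form-∼ {u} {v} (k , _ , e) z = trans (form-cong {v} {λ i → k * u i} (λ i → sym (e i)))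
        (combination₁ _ z (form-scale k u))

      f≈norm : ∀ x → f x ≈ δ * (x * x ̄)
      f≈norm x = trans (+-congʳ (trans
        (+-cong (*-congʳ α≈0) (*-congʳ (trans (bar-cong α≈0) bar-0)))
        (solve 2 (λ y z → :0 :* y :+ :0 :* z := :0) refl (x * x) (x ̄ * x ̄)))) (+-identityˡ _)

      form-affine : ∀ x y → form ⟨ x , y , 1# ⟩ ≈ y + y ̄ + f x
      form-affine x y = +-cong (+-cong (trans (*-congˡ bar-1) (*-identityʳ y)) (*-identityʳ (y ̄)))
        (sym (f≈norm x))

      𝒰⇒form≈0 : ∀ {P} → P ∈ 𝒰 α β → form (coords P) ≈ 0#
      𝒰⇒form≈0 {P} P∈𝒰 = [ on-affine , at-infinity ]′ (𝒰⇒affine {P} P∈𝒰)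
        where
        on-affine : (∃₂ λ x y → coords P ∼ ⟨ x , y , 1# ⟩ × y + y ̄ ≈ f x) → form (coords P) ≈ 0#
        on-affine (x , y , P∼ , e) = form-∼ (∼-sym P∼) (trans (form-affine x y) (≈⇒+≈0 e))
        at-infinity : coords P ∼ e₂ → form (coords P) ≈ 0#
        at-infinity P∼ = form-∼ (∼-sym P∼) (trans
          (+-cong (+-congʳ (*-congˡ bar-0)) (*-congˡ (*-congˡ bar-0)))
          (solve 2 (λ a d → :1 :* :0 :+ a :* :0 :+ d :* (:0 :* :0) := :0) refl (1# ̄) δ))

      -- On z = 0 the form reduces to δxx̄, so (0,1,0) is its only zero there.
      form≈0⇒𝒰 : ∀ P → form (coords P) ≈ 0# → P ∈ 𝒰 α β
      form≈0⇒𝒰 P z = by-cases (coords P 2F ≟ 0#)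
        where
        by-cases : Dec (coords P 2F ≈ 0#) → P ∈ 𝒰 α β
        by-cases (no P₂≉0) = let x , y , xy∼P = affine-coords (coords P) P₂≉0 in
          affine∈𝒰 {P} (∼-sym xy∼P) (+≈0⇒≈ (trans (sym (form-affine x y)) (form-∼ (∼-sym xy∼P) z)))
        by-cases (yes P₂≈0) = inj₂ (∼-sym (coords P 1F , ≉0⇒#0 P₁≉0 , λ where
            0F → trans (zeroʳ _) (sym P₀≈0)
            1F → *-identityʳ _
            2F → trans (zeroʳ _) (sym P₂≈0)))
          where
          P₀≈0 : coords P 0F ≈ 0#
          P₀≈0 = decidable-stable (coords P 0F ≟ 0#) λ P₀≉0 → *-≉0 δ≉0 (*-≉0 P₀≉0 (bar-≉0 P₀≉0))
            (combination₃ _ _ _ z (trans (bar-cong P₂≈0) bar-0) P₂≈0 (solve 5 (λ y y′ z z′ w →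
              w := :1 :* (y :* z′ :+ y′ :* z :+ w) :+ y :* z′ :+ y′ :* z)
              refl (coords P 1F) (coords P 1F ̄) (coords P 2F) (coords P 2F ̄)
              (δ * (coords P 0F * coords P 0F ̄))))
          P₁≉0 : coords P 1F ≉ 0#
          P₁≉0 P₁≈0 = nonZero-⊥ (coords P) (coords-nonZero P) P₀≈0 P₁≈0 P₂≈0

      -- With y = β̄ Y + β Z and z = Y + Z one has y z̄ + ȳ z = δ (Y Ȳ + Z Z̄).
      diagonalise : Projectivity
      diagonalise = columns-projectivity e₁ ⟨ 0# , β ̄ , 1# ⟩ ⟨ 0# , β , 1# ⟩
        λ e → δ≉0 (trans (solve 2 (λ b b′ → b′ :+ b := :det :1 :0 :0 :0 b′ :1 :0 b :1) refl β (β ̄)) e)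

      -- Spelled out so as to agree definitionally with the sum in `hermitianCurve`.
      norms : Triple → Carrier
      norms v = v 0F ^′ (q ℕ.+ 1) + (v 1F ^′ (q ℕ.+ 1) + (v 2F ^′ (q ℕ.+ 1) + 0#))

      form-diagonalise : ∀ v → form (Projectivity.matrix diagonalise *ᵥ v) ≈ δ * norms v
      form-diagonalise v = trans
        (+-cong (+-cong (*-cong y≈ (bar-z)) (*-cong bar-y z≈)) (*-congˡ (*-cong x≈ (bar-cong x≈))))
        (trans
          (solve 8 (λ b b′ x x′ y y′ z z′ →
            (b′ :* y :+ b :* z) :* (y′ :+ z′) :+ (b :* y′ :+ b′ :* z′) :* (y :+ z)
              :+ (b′ :+ b) :* (x :* x′) :=
            (b′ :+ b) :* (x′ :* x :+ (y′ :* y :+ (z′ :* z :+ :0))))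
            refl β (β ̄) (v 0F) (v 0F ̄) (v 1F) (v 1F ̄) (v 2F) (v 2F ̄))
          (*-congˡ (sym (+-cong (^[q+1] _) (+-cong (^[q+1] _) (+-congʳ (^[q+1] _)))))))
        where
        w : Triple
        w = Projectivity.matrix diagonalise *ᵥ v
        x≈ : w 0F ≈ v 0F
        x≈ = solve 3 (λ x y z → :dot :1 :0 :0 x y z := x) refl (v 0F) (v 1F) (v 2F)
        y≈ : w 1F ≈ β ̄ * v 1F + β * v 2F
        y≈ = solve 5 (λ b b′ x y z → :dot :0 b′ b x y z := b′ :* y :+ b :* z) refl
          β (β ̄) (v 0F) (v 1F) (v 2F)
        z≈ : w 2F ≈ v 1F + v 2F
        z≈ = solve 3 (λ x y z → :dot :0 :1 :1 x y z := y :+ z) refl (v 0F) (v 1F) (v 2F)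
        bar-y : w 1F ̄ ≈ β * v 1F ̄ + β ̄ * v 2F ̄
        bar-y = trans (bar-cong y≈) (trans (bar-+ _ _)
          (+-cong (trans (bar-* _ _) (*-congʳ (bar-involutive β))) (bar-* _ _)))
        bar-z : w 2F ̄ ≈ v 1F ̄ + v 2F ̄
        bar-z = trans (bar-cong z≈) (bar-+ _ _)

  -- Transport along the collineation φ

  module Image {a} (U : Pred Point a) (α β : Carrier) (φ : Collineation)
    (U≐φ𝒰 : U ≐ Collineation.image φ (𝒰 α β)) where

    open CollineationProperties φ
    module Φ = SemilinearProperties (fundamental-theorem φ)

    U⇒𝒰 : ∀ {P} → P ∈ U → ∃ λ Q → Q ∈ 𝒰 α β × coords (to Q) ∼ coords P
    U⇒𝒰 = proj₁ U≐φ𝒰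

    𝒰⇒U : ∀ {P} Q → Q ∈ 𝒰 α β → coords (to Q) ∼ coords P → P ∈ U
    𝒰⇒U Q Q∈𝒰 Q∼P = proj₂ U≐φ𝒰 (Q , Q∈𝒰 , Q∼P)

    -- The collineation `diagonalise` followed by φ maps the Hermitian curve onto U, and it splits
    -- as σ followed by g. As σ commutes with the power q + 1, it preserves the Hermitian curve, so
    -- g alone maps that curve onto U.
    classical : β ∉ 𝔽q → α ≈ 0# → IsClassical U
    classical β∉𝔽q α≈0 = g , H⊇U , U⊇H
      where
      open AffineUnital α β β∉𝔽q
      open Classical α≈0
      M = Projectivity.matrix diagonalise
      module Δ = CollineationProperties (projectivityCollineation diagonalise)
      ψ : Collineation
      ψ = φ ∘ᶜ projectivityCollineation diagonalise
      s : Semilinear ψ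
      s = fundamental-theorem ψ
      open Semilinear s using (σ; σ-cong; σ-injective; σ-surjective; σ-0; σ-+; to-σ)
        renaming (projectivity to g)
      open SemilinearProperties s using (σᵥ; σ-≉0; σ-^)
      matrix = Projectivity.matrix g
      σ-norms : ∀ v → σ (norms v) ≈ norms (σᵥ v)
      σ-norms v = trans (σ-+ _ _) (+-cong (σ-^ _ (q ℕ.+ 1)) (trans (σ-+ _ _)
        (+-cong (σ-^ _ (q ℕ.+ 1)) (trans (σ-+ _ _) (+-cong (σ-^ _ (q ℕ.+ 1)) σ-0)))))
      H⊇U : ∀ {P} → P ∈ U → P ∈ Projectivity.image g hermitianCurve
      H⊇U {P} P∈U = let Q , Q∈𝒰 , Q∼P = U⇒𝒰 P∈U
                        R = Δ.from Q
                        MR≈Q = Projectivity.inverseʳ diagonalise (coords Q)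
                        i , Ri≉0 = coords-nonZero R
        in point (σᵥ (coords R)) (i , σ-≉0 Ri≉0) ,
          trans (sym (σ-norms (coords R))) (trans (σ-cong (*-≈0 δ≉0 (trans
            (sym (form-diagonalise (coords R)))
            (trans (form-cong {M *ᵥ coords R} {coords Q} MR≈Q) (𝒰⇒form≈0 {Q} Q∈𝒰))))) σ-0) ,
          ∼-trans (to-σ R) (∼-trans
            (to-∼ (Δ.to R) Q
              (∼-reflexive MR≈Q)) Q∼P)
      U⊇H : ∀ {P} → P ∈ Projectivity.image g hermitianCurve → P ∈ U
      U⊇H {P} (Q , Q∈H , gQ∼P) = 𝒰⇒U {P} MR
          (form≈0⇒𝒰 MR (trans (form-diagonalise R) (trans (*-congˡ R∈H) (zeroʳ δ))))
          (∼-trans (∼-sym (to-σ (point R R≉0))) (∼-trans (*ᵥ-∼ matrix (∼-reflexive σR≈Q)) gQ∼P))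
        where
        R : Triple
        R i = proj₁ (σ-surjective (coords Q i))
        σR≈Q : ∀ i → σᵥ R i ≈ coords Q i
        σR≈Q i = proj₂ (σ-surjective (coords Q i))
        R≉0 : NonZero R
        R≉0 = let i , Qi≉0 = coords-nonZero Q in
          i , λ Ri≈0 → Qi≉0 (trans (sym (σR≈Q i)) (trans (σ-cong Ri≈0) σ-0))
        MR : Point
        MR = Δ.to (point R R≉0)
        σ-norms-cong : norms (σᵥ R) ≈ norms (coords Q)
        σ-norms-cong = +-cong (^′-cong (σR≈Q 0F))
          (+-cong (^′-cong (σR≈Q 1F)) (+-congʳ (^′-cong (σR≈Q 2F))))
          where
          ^′-cong : ∀ {x y} → x ≈ y → x ^′ (q ℕ.+ 1) ≈ y ^′ (q ℕ.+ 1)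
          ^′-cong = Exp.^-congˡ commutativeSemiring (q ℕ.+ 1)
        R∈H : norms R ≈ 0#
        R∈H = σ-injective (trans (σ-norms R) (trans σ-norms-cong (trans Q∈H (sym σ-0))))

    -- A tangent at T pulls back to a tangent at the preimage of T: a second common point with the
    -- preimage of U would map to a second point of U on m.
    pedal-preimage : ∀ {P P₀ Q} → coords (to P₀) ∼ coords P → Q ∈ pedal U P →
      ∃ λ Q₀ → Q₀ ∈ pedal (𝒰 α β) P₀ × coords (to Q₀) ∼ coords Q
    pedal-preimage {P} {P₀} {Q} P₀∼P (Q∈U , m , (T , T∈U , TIm , unique) , PIm , QIm) =
      let Q₀ , Q₀∈𝒰 , Q₀∼Q = U⇒𝒰 {Q} Q∈U
          T₀ , T₀∈𝒰 , T₀∼T = U⇒𝒰 {T} T∈U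
          m₀ , m₀≉0 , m₀⇔m = Φ.preimage-line (coords m) (coords-nonZero m)
          pull : ∀ {R₀} R → coords (to R₀) ∼ coords R → R I m → dot m₀ (coords R₀) ≈ 0#
          pull {R₀} R R₀∼R RIm = Equivalence.from (m₀⇔m R₀) (dot-∼ (coords m) (∼-sym R₀∼R) RIm)
      in Q₀ , (Q₀∈𝒰 , point m₀ m₀≉0 ,
        (T₀ , T₀∈𝒰 , pull {T₀} T T₀∼T TIm , λ R₀ R₀∈𝒰 R₀Im₀ →
          to-injective R₀ T₀ (∼-trans
            (unique (to R₀) (𝒰⇒U {to R₀} R₀ R₀∈𝒰 ∼-refl) (Equivalence.to (m₀⇔m R₀) R₀Im₀))
            (∼-sym T₀∼T))) ,
        pull {P₀} P P₀∼P PIm , pull {Q₀} Q Q₀∼Q QIm) , Q₀∼Q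

    module Pedal (β∉𝔽q : β ∉ 𝔽q) (α≉0 : α ≉ 0#) {t}
      (tδ²≈N : t * (β ̄ + β) ^′ 2 ≈ α ^′ (q ℕ.+ 1)) (Tr-t : Tr t ≈ 0#)
      {P a b} (P₀∼P : coords (to (affine a b)) ∼ coords P) where

      open AffineUnital α β β∉𝔽q
      open NonClassical α≉0 tδ²≈N Tr-t

      footPoint : Carrier → Point
      footPoint e = point (foot a b e) (2F , 1≉0)

      pedal⇒footPoint : ∀ {Q} → Q ∈ pedal U P →
        ∃ λ e → coords (to (footPoint e)) ∼ coords Q × f e ≈ κ a b
      pedal⇒footPoint {Q} Q∈pedal =
        let Q₀ , Q₀∈pedal , Q₀∼Q = pedal-preimage {P} {affine a b} {Q} P₀∼P Q∈pedal
            e , Q₀∼foot , fe≈κ = pedal⇒foot {affine a b} {Q₀} a b ∼-refl Q₀∈pedal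
        in e , ∼-trans (to-∼ (footPoint e) Q₀ (∼-sym Q₀∼foot)) Q₀∼Q , fe≈κ

      pedal-isArc : IsArc (pedal U P)
      pedal-isArc m A B C A∈ B∈ C∈ AIm BIm CIm =
        let e₁ , A∼ , f₁ = pedal⇒footPoint {A} A∈
            e₂ , B∼ , f₂ = pedal⇒footPoint {B} B∈
            e₃ , C∼ , f₃ = pedal⇒footPoint {C} C∈
        in ⊎-map (same A B A∼ B∼) (⊎-map (same A C A∼ C∼) (same B C B∼ C∼))
          (collinear-feet a b m₀ m₀≉0 f₁ f₂ f₃ (pull A A∼ AIm) (pull B B∼ BIm) (pull C C∼ CIm))
        where
        preimage = Φ.preimage-line (coords m) (coords-nonZero m)
        m₀ = proj₁ preimage
        m₀≉0 = proj₁ (proj₂ preimage)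
        pull : ∀ {e} Q → coords (to (footPoint e)) ∼ coords Q → Q I m → dot m₀ (foot a b e) ≈ 0#
        pull {e} Q Q∼ QIm =
          Equivalence.from (proj₂ (proj₂ preimage) (footPoint e)) (dot-∼ (coords m) (∼-sym Q∼) QIm)
        same : ∀ {e e′} Q R → coords (to (footPoint e)) ∼ coords Q →
          coords (to (footPoint e′)) ∼ coords R → e ≈ e′ → Q ≈ₚ R
        same {e} {e′} Q R Q∼ R∼ e≈e′ = ∼-trans (∼-sym Q∼) (∼-trans
          (to-∼ (footPoint e) (footPoint e′) (∼-reflexive (foot-cong a b e≈e′))) R∼)

      -- In this chart the foot with parameter e is (δ e ē, 1, e), and δ e ē lies in 𝔽q.
      chart : Projectivity
      chart = columns-projectivity e₂ ⟨ a , b , 1# ⟩ ⟨ 1# , δ * a ̄ , 0# ⟩ λ e → 1≉0 (trans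
        (solve 3 (λ a b d → :1 := :det :0 :1 :0 a b :1 :1 d :0) refl a b (δ * a ̄)) e)

      chart-foot : ∀ e i → (Projectivity.matrix chart *ᵥ ⟨ δ * (e * e ̄) , 1# , e ⟩) i ≈ foot a b e i
      chart-foot e 0F = solve 3 (λ n a e → :dot :0 a :1 n :1 e := a :+ e) refl (δ * (e * e ̄)) a e
      chart-foot e 1F = solve 4 (λ n b d e → :dot :1 b d n :1 e := b :+ d :* e :+ n) refl
        (δ * (e * e ̄)) b (δ * a ̄) e
      chart-foot e 2F = solve 2 (λ n e → :dot :0 :1 :0 n :1 e := :1) refl (δ * (e * e ̄)) e

      module Δ = CollineationProperties (projectivityCollineation chart)

      ψ : Collineation
      ψ = φ ∘ᶜ projectivityCollineation chart

      open Semilinear (fundamental-theorem ψ)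
      open SemilinearProperties (fundamental-theorem ψ) using (σᵥ; σ-^)
      open Projectivity projectivity using (matrix; inverse)

      line : ∀ m → NonZero m → Line
      line m m≉0 = point (m ᵥ* inverse) (ᵥ*-nonZero (inverseProjectivity projectivity) m≉0)

      on-line : ∀ m v w → matrix *ᵥ v ∼ w → dot m v ≈ 0# → dot (m ᵥ* inverse) w ≈ 0#
      on-line m v w v∼w d = dot-∼ (m ᵥ* inverse) {matrix *ᵥ v} {w} v∼w
        (trans (dot-projectivity projectivity m v) d)

      off-line : ∀ m v w → matrix *ᵥ v ∼ w → dot (m ᵥ* inverse) w ≈ 0# → dot m v ≈ 0#
      off-line m v w v∼w d = trans (sym (dot-projectivity projectivity m v))
        (dot-∼ (m ᵥ* inverse) {w} {matrix *ᵥ v} (∼-sym v∼w) d)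

      -- The chart sends E₃ to (1,δā,0), the vertex before φ is applied.
      V : Point
      V = to (Δ.to E₃)

      V∼ : matrix *ᵥ e₃ ∼ coords V
      V∼ = ∼-trans (*ᵥ-∼ matrix (∼-reflexive {e₃} {σᵥ e₃} λ where
          0F → sym σ-0
          1F → sym σ-0
          2F → sym σ-1)) (to-σ E₃)

      -- Only the linear part of ψ is applied, so that this is a Baer subline by definition; σ maps
      -- the standard subline to itself.
      subline : Pred Point (c ⊔ ℓ₁ ⊔ ℓ₂)
      subline = Projectivity.image projectivity standardBaerSubline

      pencil : Pred Line (c ⊔ ℓ₁ ⊔ ℓ₂)
      pencil m = V I m × ∃ λ X → X ∈ subline × X I m

      V∈ℓ∞ : Collineation.Fixes φ ℓ∞ → V I ℓ∞
      V∈ℓ∞ fixes = Equivalence.to (fixes (Δ.to E₃)) (trans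
        (dot-comm e₃ (coords (Δ.to E₃))) (trans (dot-e₃ (coords (Δ.to E₃)))
          (solve 0 (:dot :0 :1 :0 :0 :0 :1 := :0) refl)))

      pencil-isBaerPencil : IsBaerPencil V pencil
      pencil-isBaerPencil = subline , (projectivity , (λ X∈ → X∈) , (λ X∈ → X∈)) ,
        (line e₃ (2F , 1≉0) , subline-on-line , V-off-line) , (λ m∈ → m∈) , (λ m∈ → m∈)
        where
        subline-on-line : ∀ X → X ∈ subline → X I line e₃ (2F , 1≉0)
        subline-on-line X (Q , (x , y , _ , _ , Q∼) , gQ∼X) =
          on-line e₃ (coords Q) (coords X) gQ∼X
            (dot-∼ e₃ {⟨ x , y , 0# ⟩} {coords Q} (∼-sym Q∼) (dot-e₃′ x y))
          where
          dot-e₃′ : ∀ x y → dot e₃ ⟨ x , y , 0# ⟩ ≈ 0#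
          dot-e₃′ = solve 2 (λ x y → :dot :0 :0 :1 x y :0 := :0) refl
        V-off-line : ¬ (V I line e₃ (2F , 1≉0))
        V-off-line d = 1≉0 (trans (sym (dot-e₃ e₃)) (off-line e₃ e₃ (coords V) V∼ d))

      pedal-on-pencil : ∀ Q → Q ∈ pedal U P → ∃ λ m → m ∈ pencil × Q I m
      pedal-on-pencil Q Q∈pedal =
        let e , foot∼Q , _ = pedal⇒footPoint {Q} Q∈pedal in on-pencil e foot∼Q
        where
        on-pencil : ∀ e → coords (to (footPoint e)) ∼ coords Q → ∃ λ m → m ∈ pencil × Q I m
        -- Before the linear part of ψ, the line [1,r,0] joins e₃ to (r,1,0), a point of the
        -- standard subline as r is in 𝔽q, and contains (r,1,σ(e)), the chart coordinates of the
        -- foot after σ.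
        on-pencil e foot∼Q = line ⟨ 1# , r , 0# ⟩ (0F , 1≉0) ,
          (on-line ⟨ 1# , r , 0# ⟩ e₃ (coords V) V∼ (solve 1 (λ r → :dot :1 r :0 :0 :0 :1 := :0) refl r) ,
           X , (Y , (r , 1# , r∈𝔽q , bar-1 , ∼-refl) , ∼-refl) ,
           on-line ⟨ 1# , r , 0# ⟩ ⟨ r , 1# , 0# ⟩ (coords X) ∼-refl
             (solve 1 (λ r → :dot :1 r :0 r :1 :0 := :0) refl r)) ,
          on-line ⟨ 1# , r , 0# ⟩ (σᵥ (coords R)) (coords Q) R∼Q (trans (dot-congʳ ⟨ 1# , r , 0# ⟩
            {σᵥ (coords R)} {⟨ r , 1# , σ e ⟩} λ where
              0F → refl
              1F → σ-1
              2F → refl)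
            (solve 2 (λ r e → :dot :1 r :0 r :1 e := :0) refl r (σ e)))
          where
          r : Carrier
          r = σ (δ * (e * e ̄))
          r∈𝔽q : r ∈ 𝔽q
          r∈𝔽q = trans (sym (σ-^ _ q)) (σ-cong (trans (bar-* _ _) (*-cong bar-δ (norm∈𝔽q e))))
          R Y X : Point
          R = point ⟨ δ * (e * e ̄) , 1# , e ⟩ (1F , 1≉0)
          Y = point ⟨ r , 1# , 0# ⟩ (1F , 1≉0)
          X = point (matrix *ᵥ coords Y) (*ᵥ-nonZero projectivity {coords Y} (1F , 1≉0))
          R∼Q : matrix *ᵥ σᵥ (coords R) ∼ coords Q
          R∼Q = ∼-trans (to-σ R) (∼-trans
            (to-∼ (Δ.to R) (footPoint e) (∼-reflexive (chart-foot e))) foot∼Q)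

theorem1p7 : ∀ {c ℓ₁ ℓ₂ u} (h : ℕ) → 1 ≤ h →
    (K : HeytingField c ℓ₁ ℓ₂) → HasOrder K ((2 ^ h) ^ 2) →
    let open Plane h K in
    (U : Pred Point u) → IsOrthogonalBuekenhoutMetz U → ¬ IsClassical U →
    (P : Point) → P ∉ U → ¬ (P I ℓ∞) →
    (∃₂ λ V 𝓛 → V I ℓ∞ × IsBaerPencil V 𝓛
      × (∀ Q → Q ∈ pedal U P → ∃ λ m → m ∈ 𝓛 × Q I m))
    × IsArc (pedal U P)
theorem1p7 h _ K ord U (α , β , (β∉𝔽q , t , tδ²≈N , Tr-t) , φ , fixes , U≐φ𝒰) nonClassical P _ P∉ℓ∞ =
  (V , pencil , V∈ℓ∞ fixes , pencil-isBaerPencil , pedal-on-pencil) , pedal-isArc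
  where
  open Plane h K
  open HeytingField K hiding (zero)
  open ProjectivePlane h K ord
  open Image U α β φ U≐φ𝒰
  open CollineationProperties φ
  -- As φ fixes the line at infinity, the preimage of P is affine.
  finite : coords (from P) 2F ≉ 0#
  finite z≈0 = P∉ℓ∞ (dot-∼ e₃ (to∘from P) (Equivalence.to (fixes (from P))
    (trans (dot-comm e₃ (coords (from P))) (trans (dot-e₃ (coords (from P))) z≈0))))
  chartOfP : ∃₂ λ a b → ⟨ a , b , 1# ⟩ ∼ coords (from P)
  chartOfP = affine-coords (coords (from P)) finite
  a b : Carrier
  a = proj₁ chartOfP
  b = proj₁ (proj₂ chartOfP)
  open Pedal β∉𝔽q (λ α≈0 → nonClassical (classical β∉𝔽q α≈0)) tδ²≈N Tr-t {P} {a} {b}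
    (∼-trans (to-∼ (affine a b) (from P) (proj₂ (proj₂ chartOfP))) (to∘from P))
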